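{- Let $G_n$ be a graph chosen uniformly at random among all unlabeled outerplanar graphs on $n$ vertices. Then the probability that the chromatic number of $G_n$ is different from $3$ tends to zero exponentially fast as $n\to\infty$.
   Context: An outerplanar graph is a graph that can be embedded in the plane with all vertices on the outer face. Unlabeled graphs are counted up to isomorphism (so the uniform distribution is over isomorphism classes). -}

module Defs where

open import Data.Nat using (ℕ; _<_)
open import Data.Fin using (Fin; toℕ)
open import Data.Bool using (Bool; true; false)
open import Data.Product using (Σ; _×_; ∃)
open import Data.Empty using (⊥)
open import Data.List using (List)
open import Data.List.Relation.Unary.All using (All)
open import Data.List.Relation.Unary.Any using (Any)
open import Data.List.Relation.Unary.AllPairs using (AllPairs)
open import Relation.Nullary using (¬_)
open import Relation.Binary.PropositionalEquality using (_≡_; _≢_)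
open import Function.Bundles using (_↔_; Inverse)

record Graph (n : ℕ) : Set where
  field
    adj    : Fin n → Fin n → Bool
    sym    : ∀ i j → adj i j ≡ adj j i
    irrefl : ∀ i → adj i i ≡ false
open Graph public

Iso : ∀ {n} → Graph n → Graph n → Set
Iso {n} G H = Σ (Fin n ↔ Fin n) λ σ →
  ∀ i j → adj G i j ≡ adj H (Inverse.to σ i) (Inverse.to σ j)

-- Outerplanarity: the vertices can be placed on a circle (in the cyclic
-- order given by the bijection pos : vertices → positions) such that the
-- edges, drawn as chords, do not cross; i.e. there are no edges ab, cd
-- with pos a < pos c < pos b < pos d.
Outerplanar : ∀ {n} → Graph n → Set
Outerplanar {n} G = Σ (Fin n ↔ Fin n) λ π →
  let p = λ (v : Fin n) → toℕ (Inverse.to π v) in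
  ∀ a b c d → adj G a b ≡ true → adj G c d ≡ true →
    p a < p c → p c < p b → p b < p d → ⊥

Colorable : ∀ {n} → Graph n → ℕ → Set
Colorable {n} G k = Σ (Fin n → Fin k) λ c →
  ∀ i j → adj G i j ≡ true → c i ≢ c j

ChromaticNumber : ∀ {n} → Graph n → ℕ → Set
ChromaticNumber G k = Colorable G k × (∀ m → m < k → ¬ Colorable G m)

IsOuterplanarTransversal : ∀ {n} → List (Graph n) → Set
IsOuterplanarTransversal {n} T =
  All Outerplanar T ×
  AllPairs (λ G H → ¬ Iso G H) T ×
  (∀ (G : Graph n) → Outerplanar G → Any (Iso G) T)

module Submission where

-- Both sides are compared with exponentials: 27/5 < 11/2.
--
-- Upper bound. Outerplanar graphs are 3-colourable, so χ ≠ 3 forces G to be triangle-free.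
-- Draw G with noncrossing arcs on a line. Reversing segments that hang on a single vertex,
-- one can reach a drawing in which every vertex has a left neighbour unless no edge passes
-- from the vertices before it to the rest. Scanning it from left to right with the stack of
-- still visible vertices, each new vertex w pops down to its leftmost neighbour, recording
-- for each popped vertex whether it is adjacent to w; this word determines G. Consecutive
-- entries of the stack are adjacent, so in a triangle-free graph the popped neighbours of w
-- are isolated among the pops, and there are at most (27/5)ⁿ such words.
--
-- Lower bound. The same scan encodes the dissections of an n-gon; there are at least
-- c (11/2)ⁿ of them. The polygon is the only Hamiltonian cycle of a dissection, so an
-- isomorphism is determined by the images of two consecutive vertices, and each isomorphism
-- class contains at most n² dissections. Bernoulli's inequality absorbs the factor n².

open import Defs renaming (sym to adj-sym; irrefl to adj-irrefl)
open import Data.Bool using (Bool; true; false)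
import Data.Bool.Properties as Bool
open import Data.Empty using (⊥; ⊥-elim)
open import Data.Fin using (Fin; zero; suc; toℕ; fromℕ<)
import Data.Fin.Properties as Fin
open import Data.Fin.Properties using (toℕ-injective; toℕ-fromℕ<; toℕ<n)
open import Data.List using (List; []; _∷_; _++_; map; length; replicate; cartesianProduct; allFin)
open import Data.List.Membership.Propositional using (_∈_; find; lose)
open import Data.List.Membership.Propositional.Properties using (∈-map⁺; ∈-map⁻; ∈-++⁺ˡ; ∈-++⁺ʳ; ∈-++⁻; ∈-cartesianProduct⁺; ∈-allFin)
open import Data.List.Properties using (length-map; length-++; length-tabulate; ∷-injectiveˡ; ∷-injectiveʳ)
open import Data.List.Relation.Unary.All as All using (All; []; _∷_)
open import Data.List.Relation.Unary.AllPairs using (AllPairs; []; _∷_)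
open import Data.List.Relation.Unary.Any as Any using (Any; here; there)
open import Data.List.Relation.Unary.Unique.Propositional using (Unique)
import Data.List.Relation.Unary.Unique.Propositional.Properties as Unique
open import Data.Nat using (ℕ; zero; suc; _+_; _*_; _^_; _≤_; _<_; _≤?_; _<?_; _∸_; z≤n; s≤s)
open import Data.Nat.Properties
open import Data.Nat.Tactic.RingSolver using (solve-∀)
open import Data.Product using (Σ; ∃; _×_; _,_; proj₁; proj₂)
open import Data.Product.Properties using (≡-dec)
open import Data.List.Membership.DecPropositional (≡-dec _≟_ _≟_) using (_∈?_)
open import Data.Sum using (_⊎_; inj₁; inj₂; swap)
open import Data.Unit using (tt)
open import Data.Vec using (lookup) renaming ([] to []ᵥ; _∷_ to _∷ᵥ_)
open import Function using (_∘_; id)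
open import Function.Bundles using (Inverse; mk⇔)
open import Function.Properties.Inverse using (↔-refl; ↔-sym; ↔-trans)
open import Relation.Binary.Definitions using (tri<; tri≈; tri>)
open import Relation.Binary.PropositionalEquality using (_≡_; _≢_; refl; sym; trans; cong; cong₂; subst; subst₂)
open import Relation.Nullary using (¬_; Dec; yes; no; does)
open import Relation.Nullary.Decidable using (toWitness; dec-true; dec-false; does-⇔; _×-dec_; _⊎-dec_; ¬?)

-- Counting by codes

remove : ∀ {A : Set} {y : A} (ys : List A) → y ∈ ys →
  ∃ λ zs → length ys ≡ suc (length zs) × (∀ {y′} → y′ ∈ ys → y′ ≡ y ⊎ y′ ∈ zs)
remove (y ∷ ys) (here refl) = ys , refl , λ { (here e) → inj₁ e ; (there q) → inj₂ q }
remove (z ∷ ys) (there p) with remove ys p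
... | zs , eq , f = z ∷ zs , cong suc eq , g
  where
  g : ∀ {y′} → y′ ∈ z ∷ ys → _
  g (here e) = inj₂ (here e)
  g (there q) with f q
  ... | inj₁ e = inj₁ e
  ... | inj₂ r = inj₂ (there r)

-- Pigeonhole: deleting the code of the head from `ys` leaves codes for the tail, since elements not
-- related by `R` cannot share one. `P` is a relation because a graph may have many codes; `R` is
-- isomorphism in one use and equality in the other.
length-≤-by-codes : ∀ {A B : Set} {P : A → B → Set} {R : A → A → Set} →
  (∀ {x x′ y} → P x y → P x′ y → R x x′) →
  (xs : List A) (ys : List B) →
  AllPairs (λ x x′ → ¬ R x x′) xs → All (λ x → ∃ λ y → y ∈ ys × P x y) xs →
  length xs ≤ length ys
length-≤-by-codes inj [] ys _ _ = z≤n
length-≤-by-codes {P = P} {R} inj (x ∷ xs) ys (d ∷ ds) ((y , y∈ , p) ∷ cs) with remove ys y∈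
... | zs , eq , f = subst (suc (length xs) ≤_) (sym eq)
  (s≤s (length-≤-by-codes inj xs zs ds (All.zipWith g (d , cs))))
  where
  g : ∀ {x′} → (¬ R x x′) × (∃ λ y′ → y′ ∈ ys × P x′ y′) → ∃ λ y′ → y′ ∈ zs × P x′ y′
  g (¬r , y′ , y′∈ , p′) with f y′∈
  ... | inj₁ refl = ⊥-elim (¬r (inj p p′))
  ... | inj₂ y′∈zs = y′ , y′∈zs , p′

-- Words of triangle-free drawings and their number

data Letter : Set where
  push : Letter
  pop  : Bool → Letter

-- w is the vertex about to be inserted and s the stack of visible vertices; a push on the
-- empty stack starts a new component.
edges : List Letter → ℕ → List ℕ → List (ℕ × ℕ)
edges [] w s = []
edges (push ∷ c) w [] = edges c (suc w) (w ∷ [])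
edges (push ∷ c) w (x ∷ s) = (x , w) ∷ edges c (suc w) (w ∷ x ∷ s)
edges (pop b ∷ c) w [] = edges c w []
edges (pop true ∷ c) w (x ∷ s) = (x , w) ∷ edges c w s
edges (pop false ∷ c) w (x ∷ s) = edges c w s

-- Words with u pushes and p pops. Consecutive stack entries are adjacent, so in a
-- triangle-free graph they are not both adjacent to w: a pop true precedes a pop false.
sparse pushing popping skipping : ℕ → ℕ → List (List Letter)

sparse zero zero = [] ∷ []
sparse u p = pushing u p ++ popping u p ++ skipping u p

pushing zero p = []
pushing (suc u) p = map (push ∷_) (sparse u p)

popping u zero = []
popping u (suc p) = map (pop false ∷_) (sparse u p)

skipping u (suc (suc p)) = map (λ c → pop true ∷ pop false ∷ c) (sparse u p)
skipping u _ = []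

push-sparse : ∀ {c} u p → c ∈ sparse u p → push ∷ c ∈ sparse (suc u) p
push-sparse u p c∈ = ∈-++⁺ˡ (∈-map⁺ _ c∈)

pop-sparse : ∀ {c} u p → c ∈ sparse u p → pop false ∷ c ∈ sparse u (suc p)
pop-sparse zero p c∈ = ∈-++⁺ˡ (∈-map⁺ _ c∈)
pop-sparse (suc u) p c∈ = ∈-++⁺ʳ (pushing (suc u) (suc p)) (∈-++⁺ˡ (∈-map⁺ _ c∈))

skip-sparse : ∀ {c} u p → c ∈ sparse u p → pop true ∷ pop false ∷ c ∈ sparse u (suc (suc p))
skip-sparse zero p c∈ = ∈-++⁺ʳ (popping zero (suc (suc p))) (∈-map⁺ _ c∈)
skip-sparse (suc u) p c∈ =
  ∈-++⁺ʳ (pushing (suc u) (suc (suc p))) (∈-++⁺ʳ (popping (suc u) (suc (suc p))) (∈-map⁺ _ c∈))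

-- The weights 5/9, 1/3, 1/9 of the three kinds of steps add up to 1.
sparse-bound : ∀ u p → length (sparse u p) * 5 ^ u ≤ 9 ^ u * 3 ^ p
pushing-bound : ∀ u p → 9 * (length (pushing u p) * 5 ^ u) ≤ 5 * (9 ^ u * 3 ^ p)
popping-bound : ∀ u p → 9 * (length (popping u p) * 5 ^ u) ≤ 3 * (9 ^ u * 3 ^ p)
skipping-bound : ∀ u p → 9 * (length (skipping u p) * 5 ^ u) ≤ 1 * (9 ^ u * 3 ^ p)

steps-bound : ∀ u p → length (pushing u p ++ popping u p ++ skipping u p) * 5 ^ u ≤ 9 ^ u * 3 ^ p
steps-bound u p = *-cancelˡ-≤ 9 (begin
  9 * (length (pushing u p ++ popping u p ++ skipping u p) * 5 ^ u)
    ≡⟨ cong (λ l → 9 * (l * 5 ^ u)) (trans (length-++ (pushing u p)) (cong (a +_) (length-++ (popping u p)))) ⟩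
  9 * ((a + (b + c)) * 5 ^ u)
    ≡⟨ split a b c (5 ^ u) ⟩
  9 * (a * 5 ^ u) + (9 * (b * 5 ^ u) + 9 * (c * 5 ^ u))
    ≤⟨ +-mono-≤ (pushing-bound u p) (+-mono-≤ (popping-bound u p) (skipping-bound u p)) ⟩
  5 * X + (3 * X + 1 * X)
    ≡⟨ join X ⟩
  9 * X ∎)
  where
  open ≤-Reasoning
  a b c X : ℕ
  a = length (pushing u p)
  b = length (popping u p)
  c = length (skipping u p)
  X = 9 ^ u * 3 ^ p
  split : ∀ a b c x → 9 * ((a + (b + c)) * x) ≡ 9 * (a * x) + (9 * (b * x) + 9 * (c * x))
  split = solve-∀
  join : ∀ x → 5 * x + (3 * x + 1 * x) ≡ 9 * x
  join = solve-∀

sparse-bound zero zero = ≤-refl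
sparse-bound zero (suc p) = steps-bound zero (suc p)
sparse-bound (suc u) p = steps-bound (suc u) p

pushing-bound zero p = z≤n
pushing-bound (suc u) p = begin
  9 * (length (pushing (suc u) p) * 5 ^ suc u)
    ≡⟨ cong (λ l → 9 * (l * 5 ^ suc u)) (length-map _ (sparse u p)) ⟩
  9 * (length (sparse u p) * 5 ^ suc u) ≡⟨ before (length (sparse u p)) (5 ^ u) ⟩
  45 * (length (sparse u p) * 5 ^ u)    ≤⟨ *-monoʳ-≤ 45 (sparse-bound u p) ⟩
  45 * (9 ^ u * 3 ^ p)                  ≡⟨ after (9 ^ u) (3 ^ p) ⟩
  5 * (9 ^ suc u * 3 ^ p)               ∎
  where
  open ≤-Reasoning
  before : ∀ l x → 9 * (l * (5 * x)) ≡ 45 * (l * x)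
  before = solve-∀
  after : ∀ x y → 45 * (x * y) ≡ 5 * ((9 * x) * y)
  after = solve-∀

popping-bound u zero = z≤n
popping-bound u (suc p) = begin
  9 * (length (popping u (suc p)) * 5 ^ u)
    ≡⟨ cong (λ l → 9 * (l * 5 ^ u)) (length-map _ (sparse u p)) ⟩
  9 * (length (sparse u p) * 5 ^ u) ≤⟨ *-monoʳ-≤ 9 (sparse-bound u p) ⟩
  9 * (9 ^ u * 3 ^ p)               ≡⟨ after (9 ^ u) (3 ^ p) ⟩
  3 * (9 ^ u * 3 ^ suc p)           ∎
  where
  open ≤-Reasoning
  after : ∀ x y → 9 * (x * y) ≡ 3 * (x * (3 * y))
  after = solve-∀

skipping-bound u zero = z≤n
skipping-bound u (suc zero) = z≤n
skipping-bound u (suc (suc p)) = begin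
  9 * (length (skipping u (suc (suc p))) * 5 ^ u)
    ≡⟨ cong (λ l → 9 * (l * 5 ^ u)) (length-map _ (sparse u p)) ⟩
  9 * (length (sparse u p) * 5 ^ u) ≤⟨ *-monoʳ-≤ 9 (sparse-bound u p) ⟩
  9 * (9 ^ u * 3 ^ p)               ≡⟨ after (9 ^ u) (3 ^ p) ⟩
  1 * (9 ^ u * 3 ^ suc (suc p))     ∎
  where
  open ≤-Reasoning
  after : ∀ x y → 9 * (x * y) ≡ 1 * (x * (3 * (3 * y)))
  after = solve-∀

-- Counting dissection words

-- The last vertex is joined to its predecessor and, over the whole stack of height h above
-- the bottom, to vertex 0.
closing : ℕ → List Letter
closing zero = push ∷ []
closing (suc h) = pop true ∷ replicate h (pop false) ++ push ∷ []

-- runs h u: words inserting u vertices and the closing one, at the start of a vertex, with h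
-- entries above the bottom of the stack. Each vertex pops its predecessor with true or not at
-- all, so that the polygon's sides are edges. rest h u: the same in the middle of the pops of
-- a vertex, with u more to come after it.
rest runs : ℕ → ℕ → List (List Letter)

runs h zero = closing h ∷ []
runs zero (suc u) = map (push ∷_) (runs 1 u)
runs (suc h) (suc u) = map (push ∷_) (runs (suc (suc h)) u) ++ map (pop true ∷_) (rest h u)

rest zero u = map (push ∷_) (runs 1 u)
rest (suc h) u =
  map (push ∷_) (runs (suc (suc h)) u) ++ map (pop true ∷_) (rest h u) ++ map (pop false ∷_) (rest h u)

entry : List ℕ → ℕ → ℕ
entry [] _ = 0
entry (x ∷ xs) zero = x
entry (x ∷ xs) (suc h) = entry xs h

-- Weights per stack height for which one more vertex multiplies the weighted number of
-- words by at least 11/2: the eigenvalue recursion at 11/2 from height 0, rounded, and cut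
-- off where it turns nonpositive.
run-weight rest-weight : ℕ → ℕ
run-weight = entry (1 ∷ 6 ∷ 28 ∷ 116 ∷ 446 ∷ 1623 ∷ 5643 ∷ 18827 ∷ 60302 ∷ 184866 ∷ 538307 ∷ 1465470 ∷ 3604178 ∷ 7306987 ∷ 7849457 ∷ [])
rest-weight = entry (1 ∷ 7 ∷ 35 ∷ 151 ∷ 597 ∷ 2220 ∷ 7863 ∷ 26690 ∷ 86992 ∷ 271858 ∷ 810165 ∷ 2275635 ∷ 5879813 ∷ 13186800 ∷ [])

-- Reduces the inequalities between weights to a finite check: beyond the tables their left sides
-- compute to 0.
below-or-beyond : (P : ℕ → Set) (m : ℕ) → (∀ {h} → h < m → P h) → (∀ h → P (m + h)) → ∀ h → P h
below-or-beyond P m lo hi h with h <? m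
... | yes h<m = lo h<m
... | no h≮m = subst P (m+[n∸m]≡n (≮⇒≥ h≮m)) (hi (h ∸ m))

-- A push completes a vertex and so is discounted by 2/11; a pop stays within the same vertex and
-- keeps its full weight.
run-weight-step : ∀ h → 11 * run-weight (suc h) ≤ 2 * run-weight (suc (suc h)) + 11 * rest-weight h
run-weight-step = below-or-beyond _ 14
  (toWitness {a? = allUpTo? (λ h → 11 * run-weight (suc h) ≤? 2 * run-weight (suc (suc h)) + 11 * rest-weight h) 14} tt)
  (λ _ → z≤n)

rest-weight-step : ∀ h → 11 * rest-weight (suc h) ≤ 2 * run-weight (suc (suc h)) + 11 * (rest-weight h + rest-weight h)
rest-weight-step = below-or-beyond _ 14
  (toWitness {a? = allUpTo? (λ h → 11 * rest-weight (suc h) ≤? 2 * run-weight (suc (suc h)) + 11 * (rest-weight h + rest-weight h)) 14} tt)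
  (λ _ → z≤n)

run-weight-start : 11 * run-weight 0 ≤ 2 * run-weight 1
run-weight-start = toWitness {a? = 11 * run-weight 0 ≤? 2 * run-weight 1} tt

rest-weight-start : 11 * rest-weight 0 ≤ 2 * run-weight 1
rest-weight-start = toWitness {a? = 11 * rest-weight 0 ≤? 2 * run-weight 1} tt

abstract
  -- A round number above the largest weight, 7849457. It is opaque because only `run-weight≤max`
  -- matters later.
  max-weight : ℕ
  max-weight = 8000000

  run-weight≤max : ∀ h → run-weight h ≤ max-weight
  run-weight≤max = below-or-beyond _ 15 (toWitness {a? = allUpTo? (λ h → run-weight h ≤? 8000000) 15} tt) (λ _ → z≤n)

-- Induction along the recursion of `runs` and `rest`, one weight inequality per clause. In
-- `rest h u` the current vertex is still to be pushed, hence the exponent `suc u` there.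
runs-bound : ∀ h u → 11 ^ u * run-weight h ≤ length (runs h u) * (2 ^ u * max-weight)
rest-bound : ∀ h u → 11 ^ suc u * rest-weight h ≤ length (rest h u) * (2 ^ suc u * max-weight)

push-bound : ∀ h u → 11 ^ u * (2 * run-weight h) ≤ length (map (push ∷_) (runs h u)) * (2 ^ suc u * max-weight)
push-bound h u = begin
  11 ^ u * (2 * run-weight h)                     ≡⟨ before (11 ^ u) (run-weight h) ⟩
  2 * (11 ^ u * run-weight h)                     ≤⟨ *-monoʳ-≤ 2 (runs-bound h u) ⟩
  2 * (length (runs h u) * (2 ^ u * max-weight))  ≡⟨ after (length (runs h u)) (2 ^ u) max-weight ⟩
  length (runs h u) * (2 ^ suc u * max-weight)    ≡⟨ cong (_* (2 ^ suc u * max-weight)) (sym (length-map (push ∷_) (runs h u))) ⟩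
  length (map (push ∷_) (runs h u)) * (2 ^ suc u * max-weight) ∎
  where
  open ≤-Reasoning
  before : ∀ x y → x * (2 * y) ≡ 2 * (x * y)
  before = solve-∀
  after : ∀ l x y → 2 * (l * (x * y)) ≡ l * ((2 * x) * y)
  after = solve-∀

pop-bound : ∀ b h u → 11 ^ u * (11 * rest-weight h) ≤ length (map (pop b ∷_) (rest h u)) * (2 ^ suc u * max-weight)
pop-bound b h u = begin
  11 ^ u * (11 * rest-weight h)                  ≡⟨ before (11 ^ u) (rest-weight h) ⟩
  11 ^ suc u * rest-weight h                     ≤⟨ rest-bound h u ⟩
  length (rest h u) * (2 ^ suc u * max-weight)  ≡⟨ cong (_* (2 ^ suc u * max-weight)) (sym (length-map (pop b ∷_) (rest h u))) ⟩
  length (map (pop b ∷_) (rest h u)) * (2 ^ suc u * max-weight) ∎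
  where
  open ≤-Reasoning
  before : ∀ x y → x * (11 * y) ≡ (11 * x) * y
  before = solve-∀

first-step : ∀ u {x y} → 11 * x ≤ y → 11 ^ suc u * x ≤ 11 ^ u * y
first-step u {x} {y} le = begin
  11 ^ suc u * x     ≡⟨ shift (11 ^ u) x ⟩
  11 ^ u * (11 * x)  ≤⟨ *-monoʳ-≤ (11 ^ u) le ⟩
  11 ^ u * y         ∎
  where
  open ≤-Reasoning
  shift : ∀ x y → (11 * x) * y ≡ x * (11 * y)
  shift = solve-∀

runs-bound h zero = subst (_≤ 1 * (1 * max-weight)) (sym (+-identityʳ (run-weight h))) (subst (run-weight h ≤_) (sym (one max-weight)) (run-weight≤max h))
  where
  one : ∀ k → 1 * (1 * k) ≡ k
  one = solve-∀
runs-bound zero (suc u) = ≤-trans (first-step u run-weight-start) (push-bound 1 u)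
runs-bound (suc h) (suc u) = begin
  11 ^ suc u * run-weight (suc h)                            ≤⟨ first-step u (run-weight-step h) ⟩
  11 ^ u * (2 * run-weight (suc (suc h)) + 11 * rest-weight h)         ≡⟨ *-distribˡ-+ (11 ^ u) _ (11 * rest-weight h) ⟩
  11 ^ u * (2 * run-weight (suc (suc h))) + 11 ^ u * (11 * rest-weight h) ≤⟨ +-mono-≤ (push-bound (suc (suc h)) u) (pop-bound true h u) ⟩
  length ps * W + length qs * W                     ≡⟨ sym (*-distribʳ-+ W (length ps) (length qs)) ⟩
  (length ps + length qs) * W                       ≡⟨ cong (_* W) (sym (length-++ ps)) ⟩
  length (ps ++ qs) * W                             ∎
  where
  open ≤-Reasoning
  W : ℕ
  W = 2 ^ suc u * max-weight
  ps qs : List (List Letter)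
  ps = map (push ∷_) (runs (suc (suc h)) u)
  qs = map (pop true ∷_) (rest h u)

rest-bound zero u = ≤-trans (first-step u rest-weight-start) (push-bound 1 u)
rest-bound (suc h) u = begin
  11 ^ suc u * rest-weight (suc h)                            ≤⟨ first-step u (rest-weight-step h) ⟩
  11 ^ u * (2 * run-weight (suc (suc h)) + 11 * (rest-weight h + rest-weight h)) ≡⟨ expand (11 ^ u) (2 * run-weight (suc (suc h))) (rest-weight h) ⟩
  11 ^ u * (2 * run-weight (suc (suc h))) + (11 ^ u * (11 * rest-weight h) + 11 ^ u * (11 * rest-weight h))
    ≤⟨ +-mono-≤ (push-bound (suc (suc h)) u) (+-mono-≤ (pop-bound true h u) (pop-bound false h u)) ⟩
  length ps * W + (length qs * W + length rs * W)   ≡⟨ collect (length ps) (length qs) (length rs) W ⟩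
  (length ps + (length qs + length rs)) * W
    ≡⟨ cong (_* W) (sym (trans (length-++ ps) (cong (length ps +_) (length-++ qs)))) ⟩
  length (ps ++ qs ++ rs) * W                       ∎
  where
  open ≤-Reasoning
  W : ℕ
  W = 2 ^ suc u * max-weight
  ps qs rs : List (List Letter)
  ps = map (push ∷_) (runs (suc (suc h)) u)
  qs = map (pop true ∷_) (rest h u)
  rs = map (pop false ∷_) (rest h u)
  expand : ∀ x a b → x * (a + 11 * (b + b)) ≡ x * a + (x * (11 * b) + x * (11 * b))
  expand = solve-∀
  collect : ∀ a b c w → a * w + (b * w + c * w) ≡ (a + (b + c)) * w
  collect = solve-∀

-- Scanning words and their graphs

data Below : ℕ → List ℕ → Set where
  []  : ∀ {w} → Below w []
  _∷_ : ∀ {w x s} → x < w → Below x s → Below w (x ∷ s)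

∈-below : ∀ {w s x} → Below w s → x ∈ s → x < w
∈-below (x<w ∷ _) (here refl) = x<w
∈-below (x<w ∷ b) (there x∈) = <-trans (∈-below b x∈) x<w

weaken : ∀ {w w′ s} → w ≤ w′ → Below w s → Below w′ s
weaken _ [] = []
weaken w≤ (x<w ∷ b) = <-≤-trans x<w w≤ ∷ b

tail-below : ∀ {w x s} → Below w (x ∷ s) → Below w s
tail-below (x<w ∷ b) = weaken (<⇒≤ x<w) b

-- A popped vertex never returns to the stack and the vertex being inserted never moves back. Both
-- the absence of crossings and the decoding of words rest on this.
edge-origin : ∀ c {w s x y} → (x , y) ∈ edges c w s → w ≤ y × (x ∈ s ⊎ w ≤ x)
edge-origin (push ∷ c) {w} {[]} e with edge-origin c e
... | w<y , inj₁ (here refl) = <⇒≤ w<y , inj₂ ≤-refl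
... | w<y , inj₂ w<x = <⇒≤ w<y , inj₂ (<⇒≤ w<x)
edge-origin (push ∷ c) {w} {_ ∷ _} (here refl) = ≤-refl , inj₁ (here refl)
edge-origin (push ∷ c) {w} {_ ∷ _} (there e) with edge-origin c e
... | w<y , inj₁ (here refl) = <⇒≤ w<y , inj₂ ≤-refl
... | w<y , inj₁ (there x∈) = <⇒≤ w<y , inj₁ x∈
... | w<y , inj₂ w<x = <⇒≤ w<y , inj₂ (<⇒≤ w<x)
edge-origin (pop b ∷ c) {w} {[]} e = edge-origin c e
edge-origin (pop true ∷ c) {w} {_ ∷ _} (here refl) = ≤-refl , inj₁ (here refl)
edge-origin (pop true ∷ c) {w} {_ ∷ _} (there e) with edge-origin c e
... | w≤y , inj₁ x∈ = w≤y , inj₁ (there x∈)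
... | w≤y , inj₂ w≤x = w≤y , inj₂ w≤x
edge-origin (pop false ∷ c) {w} {_ ∷ _} e with edge-origin c e
... | w≤y , inj₁ x∈ = w≤y , inj₁ (there x∈)
... | w≤y , inj₂ w≤x = w≤y , inj₂ w≤x

no-late-edge : ∀ c {w s x} → ¬ (x , w) ∈ edges c (suc w) s
no-late-edge c e = 1+n≰n (proj₁ (edge-origin c e))

no-popped-edge : ∀ c {w s x y} → Below w (x ∷ s) → ¬ (x , y) ∈ edges c w s
no-popped-edge c (x<w ∷ b) e with proj₂ (edge-origin c e)
... | inj₁ x∈ = <-irrefl refl (∈-below b x∈)
... | inj₂ w≤x = <⇒≱ x<w w≤x

edge-< : ∀ c {w s x y} → Below w s → (x , y) ∈ edges c w s → x < y
edge-< (push ∷ c) {w} {[]} _ e = edge-< c (≤-refl ∷ []) e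
edge-< (push ∷ c) {w} {_ ∷ _} (x<w ∷ _) (here refl) = x<w
edge-< (push ∷ c) {w} {_ ∷ _} b (there e) = edge-< c (≤-refl ∷ b) e
edge-< (pop b ∷ c) {w} {[]} _ e = edge-< c [] e
edge-< (pop true ∷ c) {w} {_ ∷ _} (x<w ∷ _) (here refl) = x<w
edge-< (pop true ∷ c) {w} {_ ∷ _} b (there e) = edge-< c (tail-below b) e
edge-< (pop false ∷ c) {w} {_ ∷ _} b e = edge-< c (tail-below b) e

-- When the edge from the stack top `x` to `w` is written, the vertices strictly between them have
-- left the stack, so none of them is the left end of a later edge.
edges-noncrossing : ∀ l {w s a b c d} → Below w s →
  (a , b) ∈ edges l w s → (c , d) ∈ edges l w s → a < c → c < b → b < d → ⊥
edges-noncrossing (push ∷ l) {w} {[]} _ e e′ = edges-noncrossing l (≤-refl ∷ []) e e′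
edges-noncrossing (push ∷ l) {w} {x ∷ s} _ (here refl) (here refl) x<x _ _ = <-irrefl refl x<x
edges-noncrossing (push ∷ l) {w} {x ∷ s} (_ ∷ s<x) (here refl) (there e′) x<c c<w _ with proj₂ (edge-origin l e′)
... | inj₁ (here refl) = <-irrefl refl c<w
... | inj₁ (there (here refl)) = <-irrefl refl x<c
... | inj₁ (there (there c∈)) = <-asym x<c (∈-below s<x c∈)
... | inj₂ w<c = <-asym c<w w<c
edges-noncrossing (push ∷ l) {w} {x ∷ s} _ (there e) (here refl) _ _ b<w = <-asym b<w (proj₁ (edge-origin l e))
edges-noncrossing (push ∷ l) {w} {x ∷ s} s<w (there e) (there e′) = edges-noncrossing l (≤-refl ∷ s<w) e e′
edges-noncrossing (pop b ∷ l) {w} {[]} _ e e′ = edges-noncrossing l [] e e′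
edges-noncrossing (pop true ∷ l) {w} {x ∷ s} _ (here refl) (here refl) x<x _ _ = <-irrefl refl x<x
edges-noncrossing (pop true ∷ l) {w} {x ∷ s} (_ ∷ s<x) (here refl) (there e′) x<c c<w _ with proj₂ (edge-origin l e′)
... | inj₁ c∈ = <-asym x<c (∈-below s<x c∈)
... | inj₂ w≤c = <⇒≱ c<w w≤c
edges-noncrossing (pop true ∷ l) {w} {x ∷ s} _ (there e) (here refl) _ _ b<w = <⇒≱ b<w (proj₁ (edge-origin l e))
edges-noncrossing (pop true ∷ l) {w} {x ∷ s} s<w (there e) (there e′) = edges-noncrossing l (tail-below s<w) e e′
edges-noncrossing (pop false ∷ l) {w} {x ∷ s} s<w e e′ = edges-noncrossing l (tail-below s<w) e e′

-- Structure and decoding of dissection words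

data Run : ℕ → ℕ → List Letter → Set
data Rest : ℕ → ℕ → List Letter → Set

data Run where
  close : ∀ {h} → Run h 0 (closing h)
  push  : ∀ {h u c} → Run (suc h) u c → Run h (suc u) (push ∷ c)
  pop   : ∀ {h u c} → Rest h u c → Run (suc h) (suc u) (pop true ∷ c)

data Rest where
  push : ∀ {h u c} → Run (suc h) u c → Rest h u (push ∷ c)
  pop  : ∀ {b h u c} → Rest h u c → Rest (suc h) u (pop b ∷ c)

∈-runs : ∀ h u {c} → c ∈ runs h u → Run h u c
∈-rest : ∀ h u {c} → c ∈ rest h u → Rest h u c

∈-runs h zero (here refl) = close
∈-runs zero (suc u) c∈ with ∈-map⁻ _ c∈
... | _ , d∈ , refl = push (∈-runs 1 u d∈)
∈-runs (suc h) (suc u) c∈ with ∈-++⁻ (map (push ∷_) (runs (suc (suc h)) u)) c∈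
... | inj₁ p with ∈-map⁻ _ p
...   | _ , d∈ , refl = push (∈-runs (suc (suc h)) u d∈)
∈-runs (suc h) (suc u) c∈ | inj₂ p with ∈-map⁻ _ p
...   | _ , d∈ , refl = pop (∈-rest h u d∈)

∈-rest zero u c∈ with ∈-map⁻ _ c∈
... | _ , d∈ , refl = push (∈-runs 1 u d∈)
∈-rest (suc h) u c∈ with ∈-++⁻ (map (push ∷_) (runs (suc (suc h)) u)) c∈
... | inj₁ p with ∈-map⁻ _ p
...   | _ , d∈ , refl = push (∈-runs (suc (suc h)) u d∈)
∈-rest (suc h) u c∈ | inj₂ p with ∈-++⁻ (map (pop true ∷_) (rest h u)) p
... | inj₁ q with ∈-map⁻ _ q
...   | _ , d∈ , refl = pop (∈-rest h u d∈)
∈-rest (suc h) u c∈ | inj₂ p | inj₂ q with ∈-map⁻ _ q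
...   | _ , d∈ , refl = pop (∈-rest h u d∈)

map-disjoint : ∀ {A : Set} {a b : A} (xs ys : List (List A)) → a ≢ b →
  ∀ {c} → ¬ (c ∈ map (a ∷_) xs × c ∈ map (b ∷_) ys)
map-disjoint xs ys a≢b (p , q) with ∈-map⁻ _ p | ∈-map⁻ _ q
... | _ , _ , refl | _ , _ , e = a≢b (∷-injectiveˡ e)

runs-unique : ∀ h u → Unique (runs h u)
rest-unique : ∀ h u → Unique (rest h u)

runs-unique h zero = [] ∷ []
runs-unique zero (suc u) = Unique.map⁺ ∷-injectiveʳ (runs-unique 1 u)
runs-unique (suc h) (suc u) = Unique.++⁺ (Unique.map⁺ ∷-injectiveʳ (runs-unique (suc (suc h)) u))
  (Unique.map⁺ ∷-injectiveʳ (rest-unique h u)) (map-disjoint _ (rest h u) λ ())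

rest-unique zero u = Unique.map⁺ ∷-injectiveʳ (runs-unique 1 u)
rest-unique (suc h) u = Unique.++⁺ (Unique.map⁺ ∷-injectiveʳ (runs-unique (suc (suc h)) u))
  (Unique.++⁺ (Unique.map⁺ ∷-injectiveʳ (rest-unique h u)) (Unique.map⁺ ∷-injectiveʳ (rest-unique h u))
    (map-disjoint _ (rest h u) λ ()))
  λ { (p , q) → disjoint p (∈-++⁻ (map (pop true ∷_) (rest h u)) q) }
  where
  disjoint : ∀ {c} → c ∈ map (push ∷_) (runs (suc (suc h)) u) →
    c ∈ map (pop true ∷_) (rest h u) ⊎ c ∈ map (pop false ∷_) (rest h u) → ⊥
  disjoint p (inj₁ q) = map-disjoint _ (rest h u) (λ ()) (p , q)
  disjoint p (inj₂ q) = map-disjoint _ (rest h u) (λ ()) (p , q)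

-- When a vertex starts, its predecessor is on top of the stack, and its first letter is `push` or
-- `pop true`; either one writes this side of the polygon.
run-path : ∀ {h u c} → Run h u c → ∀ {x s i} → length s ≡ h → x ≤ i → i ≤ x + u →
  (i , suc i) ∈ edges c (suc x) (x ∷ s)
rest-path : ∀ {h u c} → Rest h u c → ∀ {w x s i} → length s ≡ h → w ≤ i → i ≤ w + u →
  (i , suc i) ∈ edges c w (x ∷ s)

run-path (close {h}) {x} {s} {i} _ x≤i i≤x with ≤-antisym x≤i (subst (i ≤_) (+-identityʳ x) i≤x)
run-path (close {zero}) _ _ _ | refl = here refl
run-path (close {suc h}) _ _ _ | refl = here refl
run-path (push r) {x} {s} {i} len x≤i i≤ with m≤n⇒m<n∨m≡n x≤i
... | inj₂ refl = here refl
... | inj₁ x<i = there (run-path r (cong suc len) x<i (subst (i ≤_) (+-suc x _) i≤))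
run-path (pop r) {x} {y ∷ s} {i} len x≤i i≤ with m≤n⇒m<n∨m≡n x≤i
... | inj₂ refl = here refl
... | inj₁ x<i = there (rest-path r (suc-injective len) x<i (subst (i ≤_) (+-suc x _) i≤))

rest-path (push r) len w≤i i≤ = there (run-path r (cong suc len) w≤i i≤)
rest-path (pop {true} r) {s = y ∷ s} len w≤i i≤ = there (rest-path r (suc-injective len) w≤i i≤)
rest-path (pop {false} r) {s = y ∷ s} len w≤i i≤ = rest-path r (suc-injective len) w≤i i≤

data Bottom (z : ℕ) : List ℕ → Set where
  [-] : Bottom z (z ∷ [])
  _∷_ : ∀ x {s} → Bottom z s → Bottom z (x ∷ s)

flush-closes : ∀ h {w z s} → length s ≡ suc h → Bottom z s →
  (z , w) ∈ edges (replicate h (pop false) ++ push ∷ []) w s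
flush-closes zero _ [-] = here refl
flush-closes zero () (x ∷ (y ∷ b))
flush-closes zero () (x ∷ [-])
flush-closes (suc h) () [-]
flush-closes (suc h) len (x ∷ b) = flush-closes h (suc-injective len) b

-- The height counts the entries above the bottom, so the bottom is never popped; the closing
-- letters clear all else and join it to the last vertex.
run-closes : ∀ {h u c} → Run h u c → ∀ {w z s} → length s ≡ suc h → Bottom z s →
  (z , w + u) ∈ edges c w s
rest-closes : ∀ {h u c} → Rest h u c → ∀ {w z s} → length s ≡ suc h → Bottom z s →
  (z , suc w + u) ∈ edges c w s

run-closes (close {zero}) {w} {z} {s} len b = subst (λ v → (z , v) ∈ edges (push ∷ []) w s)
  (sym (+-identityʳ w)) (flush-closes zero len b)
run-closes (close {suc h}) () [-]
run-closes (close {suc h}) {w} {z} {_ ∷ s} len (x ∷ b) =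
  there (subst (λ v → (z , v) ∈ edges (replicate h (pop false) ++ push ∷ []) w s) (sym (+-identityʳ w)) (flush-closes h (suc-injective len) b))
run-closes (push {u = u} {c} r) {w} {z} {x ∷ s} len b =
  there (subst (λ v → (z , v) ∈ edges c (suc w) (w ∷ x ∷ s)) (sym (+-suc w u)) (run-closes r (cong suc len) (w ∷ b)))
run-closes (pop r) () [-]
run-closes (pop {u = u} {c} r) {w} {z} {x ∷ s} len (_ ∷ b) =
  there (subst (λ v → (z , v) ∈ edges c w s) (sym (+-suc w u)) (rest-closes r (suc-injective len) b))

rest-closes (push r) {w} {s = x ∷ s} len b = there (run-closes r (cong suc len) (w ∷ b))
rest-closes (pop r) () [-]
rest-closes (pop {true} r) len (x ∷ b) = there (rest-closes r (suc-injective len) b)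
rest-closes (pop {false} r) len (x ∷ b) = rest-closes r (suc-injective len) b

rest-left-neighbour : ∀ {h u c} → Rest h u c → ∀ {w s} → length s ≡ suc h →
  ∃ λ y → y ∈ s × (y , w) ∈ edges c w s
rest-left-neighbour (push r) {s = x ∷ s} len = x , here refl , here refl
rest-left-neighbour (pop {true} r) {s = x ∷ s} len = x , here refl , here refl
rest-left-neighbour (pop {false} r) {s = x ∷ s} len with rest-left-neighbour r (suc-injective len)
... | y , y∈ , e = y , there y∈ , e

infix 4 _≈_
_≈_ : List (ℕ × ℕ) → List (ℕ × ℕ) → Set
es ≈ es′ = ∀ {e} → (e ∈ es → e ∈ es′) × (e ∈ es′ → e ∈ es)

≈-sym : ∀ {es es′} → es ≈ es′ → es′ ≈ es
≈-sym p = proj₂ p , proj₁ p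

≈-tail : ∀ {e es es′} → ¬ e ∈ es → ¬ e ∈ es′ → e ∷ es ≈ e ∷ es′ → es ≈ es′
≈-tail ∉ ∉′ p = (λ q → strip ∉ (proj₁ p (there q)) q) , (λ q → strip ∉′ (proj₂ p (there q)) q)
  where
  strip : ∀ {e e′ : ℕ × ℕ} {es es′} → ¬ e ∈ es → e′ ∈ e ∷ es′ → e′ ∈ es → e′ ∈ es′
  strip ∉ (here refl) q = ⊥-elim (∉ q)
  strip ∉ (there r) _ = r

-- After a push, `w` gets no further left neighbour; after a pop it still gets one below `x`, by
-- `rest-left-neighbour`.
push≉pop : ∀ {h u b c c′ w x s} → Below w (x ∷ s) → length s ≡ suc h → Rest h u c′ →
  ¬ edges (push ∷ c) w (x ∷ s) ≈ edges (pop b ∷ c′) w (x ∷ s)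
push≉pop {b = b} {c} {c′} {w} {x} {s} (x<w ∷ s<x) len r p with rest-left-neighbour r len
... | y , y∈ , e with proj₂ p (lift b e)
  where
  lift : ∀ b {e} → e ∈ edges c′ w s → e ∈ edges (pop b ∷ c′) w (x ∷ s)
  lift true e = there e
  lift false e = e
... | here refl = <-irrefl refl (∈-below s<x y∈)
... | there e′ = no-late-edge c e′

-- Decoding letter by letter: `push≉pop` tells a push from a pop, and the edge from `x` to `w` tells
-- the two pops apart. This edge is never written again, so it can be stripped from both lists.
run-injective : ∀ {h u c c′} → Run h u c → Run h u c′ → ∀ {w x s} → length s ≡ h → Below w (x ∷ s) →
  edges c w (x ∷ s) ≈ edges c′ w (x ∷ s) → c ≡ c′
rest-injective : ∀ {h u c c′} → Rest h u c → Rest h u c′ → ∀ {w x s} → length s ≡ h → Below w (x ∷ s) →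
  edges c w (x ∷ s) ≈ edges c′ w (x ∷ s) → c ≡ c′

run-injective close close _ _ _ = refl
run-injective (push {c = c} r) (push {c = c′} r′) len b p =
  cong (push ∷_) (run-injective r r′ (cong suc len) (≤-refl ∷ b) (≈-tail (no-late-edge c) (no-late-edge c′) p))
run-injective (push {c = c} r) (pop r′) len b p = ⊥-elim (push≉pop {b = true} {c} b len r′ p)
run-injective (pop r) (push {c = c′} r′) len b p = ⊥-elim (push≉pop {b = true} {c′} b len r (≈-sym p))
run-injective (pop {c = c} r) (pop {c = c′} r′) {s = y ∷ s} len b p =
  cong (pop true ∷_) (rest-injective r r′ (suc-injective len) (tail-below b)
    (≈-tail (no-popped-edge c b) (no-popped-edge c′ b) p))

rest-injective (push {c = c} r) (push {c = c′} r′) len b p =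
  cong (push ∷_) (run-injective r r′ (cong suc len) (≤-refl ∷ b) (≈-tail (no-late-edge c) (no-late-edge c′) p))
rest-injective (push {c = c} r) (pop {b₁} r′) len b p = ⊥-elim (push≉pop {b = b₁} {c = c} b len r′ p)
rest-injective (pop {b₁} r) (push {c = c′} r′) len b p = ⊥-elim (push≉pop {b = b₁} {c = c′} b len r (≈-sym p))
rest-injective (pop {true} {c = c} r) (pop {true} {c = c′} r′) {s = y ∷ s} len b p =
  cong (pop true ∷_) (rest-injective r r′ (suc-injective len) (tail-below b)
    (≈-tail (no-popped-edge c b) (no-popped-edge c′ b) p))
rest-injective (pop {false} r) (pop {false} r′) {s = y ∷ s} len b p =
  cong (pop false ∷_) (rest-injective r r′ (suc-injective len) (tail-below b) p)
rest-injective (pop {true} r) (pop {false} {c = c′} r′) {s = y ∷ s} len b p =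
  ⊥-elim (no-popped-edge c′ b (proj₁ p (here refl)))
rest-injective (pop {false} {c = c} r) (pop {true} r′) {s = y ∷ s} len b p =
  ⊥-elim (no-popped-edge c b (proj₂ p (here refl)))

-- Graphs from edge lists and rigidity of the Hamiltonian cycle

module _ (es : List (ℕ × ℕ)) where

  Joined : ℕ → ℕ → Set
  Joined i j = (i , j) ∈ es ⊎ (j , i) ∈ es

  joined? : ∀ i j → Dec (Joined i j)
  joined? i j = ((i , j) ∈? es) ⊎-dec ((j , i) ∈? es)

does⇒ : ∀ {P : Set} (p? : Dec P) → does p? ≡ true → P
does⇒ (yes p) _ = p

Ascending : List (ℕ × ℕ) → Set
Ascending es = ∀ i j → (i , j) ∈ es → i < j

graph : ∀ n (es : List (ℕ × ℕ)) → Ascending es → Graph n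
adj (graph n es up) i j = does (joined? es (toℕ i) (toℕ j))
adj-sym (graph n es up) i j =
  does-⇔ (mk⇔ swap swap) (joined? es (toℕ i) (toℕ j)) (joined? es (toℕ j) (toℕ i))
adj-irrefl (graph n es up) i = dec-false (joined? es (toℕ i) (toℕ i))
  λ { (inj₁ e) → <-irrefl refl (up _ _ e) ; (inj₂ e) → <-irrefl refl (up _ _ e) }

graph-edge : ∀ n es (up : Ascending es) (i j : Fin n) → adj (graph n es up) i j ≡ true → toℕ i < toℕ j → (toℕ i , toℕ j) ∈ es
graph-edge n es up i j e i<j with does⇒ (joined? es (toℕ i) (toℕ j)) e
... | inj₁ e′ = e′
... | inj₂ e′ = ⊥-elim (<-asym i<j (up _ _ e′))

graph-edge⁺ : ∀ n es (up : Ascending es) (i j : Fin n) → (toℕ i , toℕ j) ∈ es → adj (graph n es up) i j ≡ true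
graph-edge⁺ n es up i j e = dec-true (joined? es (toℕ i) (toℕ j)) (inj₁ e)

Noncrossing : ∀ {n} → Graph n → Set
Noncrossing {n} G = ∀ (a b c d : Fin n) → adj G a b ≡ true → adj G c d ≡ true →
  toℕ a < toℕ c → toℕ c < toℕ b → toℕ b < toℕ d → ⊥

graph-noncrossing : ∀ n es (up : Ascending es) →
  (∀ {a b c d} → (a , b) ∈ es → (c , d) ∈ es → a < c → c < b → b < d → ⊥) →
  Noncrossing (graph n es up)
graph-noncrossing n es up nc a b c d e e′ a<c c<b b<d =
  nc (graph-edge n es up a b e (<-trans a<c c<b)) (graph-edge n es up c d e′ (<-trans c<b b<d)) a<c c<b b<d

-- A Hamiltonian cycle of a noncrossing graph never uses a chord k y: the rest of the
-- cycle would have to visit both sides of it.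
module _ {m : ℕ} (G H : Graph (suc (suc m)))
  (path : ∀ i j → toℕ j ≡ suc (toℕ i) → adj G i j ≡ true)
  (closed : ∀ j → toℕ j ≡ suc m → adj G j zero ≡ true)
  (noncrossing : Noncrossing H)
  (iso : Iso G H)
  where

  private
    σ : Fin (suc (suc m)) → Fin (suc (suc m))
    σ = Inverse.to (proj₁ iso)

    σ-injective : ∀ {u v} → σ u ≡ σ v → u ≡ v
    σ-injective {u} {v} e = trans (sym (Inverse.strictlyInverseʳ (proj₁ iso) u))
      (trans (cong (Inverse.from (proj₁ iso)) e) (Inverse.strictlyInverseʳ (proj₁ iso) v))

    σ-path : ∀ i j → toℕ j ≡ suc (toℕ i) → adj H (σ i) (σ j) ≡ true
    σ-path i j e = trans (sym (proj₂ iso i j)) (path i j e)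

    -- The first deviation from the identity: the image of the path jumps from `k` over `v` to `y`,
    -- and returns to `v` only later, at `z`.
    module Chord (k y v : Fin (suc (suc m))) (1≤k : 1 ≤ toℕ k) (v≡ : toℕ v ≡ suc (toℕ k)) (σk≡ : σ k ≡ k) (σv≡ : σ v ≡ y)
      (v<y : toℕ v < toℕ y) (z : Fin (suc (suc m))) (v<z : toℕ v < toℕ z) (σz≡ : σ z ≡ v) (σ0≡ : σ zero ≡ zero) where

      Inside : Fin (suc (suc m)) → Set
      Inside u = toℕ k < toℕ u × toℕ u < toℕ y

      ky : adj H k y ≡ true
      ky = subst₂ (λ a b → adj H a b ≡ true) σk≡ σv≡ (σ-path k v v≡)

      k<v : toℕ k < toℕ v
      k<v = subst (toℕ k <_) (sym v≡) ≤-refl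

      stays : ∀ x x′ → adj H x x′ ≡ true → x′ ≢ k → x′ ≢ y → Inside x → Inside x′
      stays x x′ e x′≢k x′≢y (k<x , x<y) with <-cmp (toℕ k) (toℕ x′) | <-cmp (toℕ x′) (toℕ y)
      ... | tri< k<x′ _ _ | tri< x′<y _ _ = k<x′ , x′<y
      ... | tri≈ _ k≡x′ _ | _ = ⊥-elim (x′≢k (toℕ-injective (sym k≡x′)))
      ... | tri> _ _ x′<k | _ = ⊥-elim (noncrossing x′ x k y (trans (adj-sym H x′ x) e) ky x′<k k<x x<y)
      ... | tri< _ _ _ | tri≈ _ x′≡y _ = ⊥-elim (x′≢y (toℕ-injective x′≡y))
      ... | tri< _ _ _ | tri> _ _ y<x′ = ⊥-elim (noncrossing k y x x′ ky e k<x x<y y<x′)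

      -- From `z` on, the path is trapped under the chord: an edge leaving would cross it, and its
      -- ends `k` and `y` were visited before.
      walk : ∀ d (u : Fin (suc (suc m))) → toℕ u ≡ d + toℕ z → Inside (σ u)
      walk zero u u≡z with toℕ-injective {i = u} {j = z} u≡z
      ... | refl = subst Inside (sym σz≡) (k<v , v<y)
      walk (suc d) u u≡ = stays (σ u′) (σ u) (σ-path u′ u (trans u≡ (cong suc (sym u′≡)))) σu≢k σu≢y (walk d u′ u′≡)
        where
        u′< : d + toℕ z < suc (suc m)
        u′< = <-trans (subst (d + toℕ z <_) (sym u≡) ≤-refl) (toℕ<n u)
        u′ : Fin (suc (suc m))
        u′ = fromℕ< u′<
        u′≡ : toℕ u′ ≡ d + toℕ z
        u′≡ = toℕ-fromℕ< u′<
        v<u : toℕ v < toℕ u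
        v<u = <-≤-trans v<z (subst (toℕ z ≤_) (sym u≡) (m≤n+m (toℕ z) (suc d)))
        σu≢k : σ u ≢ k
        σu≢k e = <-irrefl (cong toℕ (sym (σ-injective (trans e (sym σk≡))))) (<-trans k<v v<u)
        σu≢y : σ u ≢ y
        σu≢y e = <-irrefl (cong toℕ (sym (σ-injective (trans e (sym σv≡))))) v<u

      last : Fin (suc (suc m))
      last = fromℕ< (n<1+n (suc m))

      last≡ : toℕ last ≡ suc m
      last≡ = toℕ-fromℕ< (n<1+n (suc m))

      absurd : ⊥
      -- The last vertex is trapped too, yet the closing edge joins it to 0, which lies outside
      -- because `1 ≤ toℕ k`.
      absurd with walk (suc m ∸ toℕ z) last (trans last≡ (sym (m∸n+n≡m (≤-pred (toℕ<n z)))))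
      ... | k<ℓ , ℓ<y = noncrossing zero (σ last) k y
        (trans (adj-sym H zero (σ last)) (subst (λ a → adj H (σ last) a ≡ true) σ0≡ (trans (sym (proj₂ iso last zero)) (closed last last≡))))
        ky 1≤k k<ℓ ℓ<y

  -- Fixing 0 and 1 rules out rotations and reflections of the polygon. Inductively, `σ v` is not
  -- below `v` by injectivity, and not above by `Chord`.
  fixes-all : σ zero ≡ zero → σ (suc zero) ≡ suc zero → ∀ v → σ v ≡ v
  fixes-all σ0≡ σ1≡ v = go (toℕ v) v ≤-refl
    where
    go : ∀ k (v : Fin (suc (suc m))) → toℕ v ≤ k → σ v ≡ v
    go k zero _ = σ0≡
    go k (suc zero) _ = σ1≡
    go (suc k) v@(suc (suc v′)) (s≤s v≤k) with <-cmp (toℕ (σ v)) (toℕ v)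
    ... | tri≈ _ e _ = toℕ-injective e
    ... | tri< σv<v _ _ = ⊥-elim (<-irrefl (cong toℕ (σ-injective (go k (σ v) (≤-pred (<-≤-trans σv<v (s≤s v≤k)))))) σv<v)
    ... | tri> _ _ v<σv = ⊥-elim (Chord.absurd p (σ v) v 1≤p v≡ (go k p (subst (_≤ k) (sym p≡) v≤k)) refl v<σv z v<z σz≡ σ0≡)
      where
      p< : toℕ (suc v′) < suc (suc m)
      p< = <-trans (n<1+n _) (toℕ<n v)
      p : Fin (suc (suc m))
      p = fromℕ< p<
      p≡ : toℕ p ≡ suc (toℕ v′)
      p≡ = toℕ-fromℕ< p<
      1≤p : 1 ≤ toℕ p
      1≤p = subst (1 ≤_) (sym p≡) (s≤s z≤n)
      v≡ : toℕ v ≡ suc (toℕ p)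
      v≡ = cong suc (sym p≡)
      z : Fin (suc (suc m))
      z = Inverse.from (proj₁ iso) v
      σz≡ : σ z ≡ v
      σz≡ = Inverse.strictlyInverseˡ (proj₁ iso) v
      v<z : toℕ v < toℕ z
      v<z with <-cmp (toℕ v) (toℕ z)
      ... | tri< lt _ _ = lt
      ... | tri≈ _ e _ = ⊥-elim (<-irrefl (cong toℕ (trans (sym σz≡) (cong σ (sym (toℕ-injective e))))) v<σv)
      ... | tri> _ _ z<v = ⊥-elim (<-irrefl (cong toℕ (trans (sym (go k z (≤-pred (<-≤-trans z<v (s≤s v≤k))))) σz≡)) z<v)

Iso-sym : ∀ {n} {G H : Graph n} → Iso G H → Iso H G
Iso-sym {G = G} {H} (σ , p) = ↔-sym σ , λ i j →
  trans (sym (cong₂ (adj H) (Inverse.strictlyInverseˡ σ i) (Inverse.strictlyInverseˡ σ j))) (sym (p _ _))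

Iso-trans : ∀ {n} {G H I : Graph n} → Iso G H → Iso H I → Iso G I
Iso-trans (σ , p) (τ , q) = ↔-trans σ τ , λ i j → trans (p i j) (q _ _)

-- Dissections up to isomorphism

run-bounded : ∀ {h u c} → Run h u c → ∀ {w s x y} → (x , y) ∈ edges c w s → y ≤ w + u
rest-bounded : ∀ {h u c} → Rest h u c → ∀ {w s x y} → (x , y) ∈ edges c w s → y ≤ suc w + u
flush-bounded : ∀ h {w s x y} → (x , y) ∈ edges (replicate h (pop false) ++ push ∷ []) w s → y ≤ w

flush-bounded zero {s = []} ()
flush-bounded zero {s = x ∷ s} (here refl) = ≤-refl
flush-bounded (suc h) {s = []} e = flush-bounded h e
flush-bounded (suc h) {s = x ∷ s} e = flush-bounded h e

run-bounded (close {zero}) {s = s} e = ≤-trans (flush-bounded 0 {s = s} e) (m≤m+n _ 0)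
run-bounded (close {suc h}) {s = []} e = ≤-trans (flush-bounded h e) (m≤m+n _ 0)
run-bounded (close {suc h}) {s = x ∷ s} (here refl) = m≤m+n _ 0
run-bounded (close {suc h}) {s = x ∷ s} (there e) = ≤-trans (flush-bounded h e) (m≤m+n _ 0)
run-bounded (push {u = u} r) {w} {[]} {y = y} e = subst (y ≤_) (sym (+-suc w u)) (run-bounded r e)
run-bounded (push r) {w} {x ∷ s} (here refl) = m≤m+n w _
run-bounded (push {u = u} r) {w} {x ∷ s} {y = y} (there e) = subst (y ≤_) (sym (+-suc w u)) (run-bounded r e)
run-bounded (pop {u = u} r) {w} {[]} {y = y} e = subst (y ≤_) (sym (+-suc w u)) (rest-bounded r e)
run-bounded (pop r) {w} {x ∷ s} (here refl) = m≤m+n w _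
run-bounded (pop {u = u} r) {w} {x ∷ s} {y = y} (there e) = subst (y ≤_) (sym (+-suc w u)) (rest-bounded r e)

rest-bounded (push r) {w} {[]} e = run-bounded r e
rest-bounded (push r) {w} {x ∷ s} (here refl) = ≤-trans (n≤1+n w) (m≤m+n (suc w) _)
rest-bounded (push r) {w} {x ∷ s} (there e) = run-bounded r e
rest-bounded (pop r) {w} {[]} e = rest-bounded r e
rest-bounded (pop {true} r) {w} {x ∷ s} (here refl) = ≤-trans (n≤1+n w) (m≤m+n (suc w) _)
rest-bounded (pop {true} r) {w} {x ∷ s} (there e) = rest-bounded r e
rest-bounded (pop {false} r) {w} {x ∷ s} e = rest-bounded r e

chords : List Letter → List (ℕ × ℕ)
chords c = edges c 1 (0 ∷ [])

chords-ascending : ∀ c → Ascending (chords c)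
chords-ascending c _ _ = edge-< c (s≤s z≤n ∷ [])

-- Vertex 0 is on the stack from the start; a word of `runs 0 m` adds `m` vertices and the closing
-- one.
dissection : ∀ m → List Letter → Graph (2 + m)
dissection m c = graph (2 + m) (chords c) (chords-ascending c)

dissection-noncrossing : ∀ m c → Noncrossing (dissection m c)
dissection-noncrossing m c =
  graph-noncrossing (2 + m) (chords c) (chords-ascending c) (edges-noncrossing c (s≤s z≤n ∷ []))

dissection-path : ∀ m {c} → Run 0 m c → ∀ i j → toℕ j ≡ suc (toℕ i) → adj (dissection m c) i j ≡ true
dissection-path m {c} r i j j≡ = graph-edge⁺ (2 + m) (chords c) (chords-ascending c) i j
  (subst (λ k → (toℕ i , k) ∈ chords c) (sym j≡)
    (run-path r refl z≤n (≤-pred (≤-pred (subst (_< 2 + m) j≡ (toℕ<n j))))))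

dissection-closed : ∀ m {c} → Run 0 m c → ∀ j → toℕ j ≡ suc m → adj (dissection m c) j zero ≡ true
dissection-closed m {c} r j j≡ = trans (adj-sym (dissection m c) j zero)
  (graph-edge⁺ (2 + m) (chords c) (chords-ascending c) zero j
    (subst (λ k → (0 , k) ∈ chords c) (sym j≡) (run-closes r refl [-])))

chords-⊆ : ∀ m {c} c′ → Run 0 m c → (∀ i j → adj (dissection m c) i j ≡ adj (dissection m c′) i j) →
  ∀ {e} → e ∈ chords c → e ∈ chords c′
chords-⊆ m {c} c′ r same {x , y} e =
  subst₂ (λ i j → (i , j) ∈ chords c′) (toℕ-fromℕ< x<n) (toℕ-fromℕ< y<n)
    (graph-edge (2 + m) (chords c′) (chords-ascending c′) i j
      (trans (sym (same i j)) (graph-edge⁺ (2 + m) (chords c) (chords-ascending c) i j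
        (subst₂ (λ i j → (i , j) ∈ chords c) (sym (toℕ-fromℕ< x<n)) (sym (toℕ-fromℕ< y<n)) e)))
      (subst₂ _<_ (sym (toℕ-fromℕ< x<n)) (sym (toℕ-fromℕ< y<n)) (chords-ascending c x y e)))
  where
  y<n : y < 2 + m
  y<n = s≤s (run-bounded r e)
  x<n : x < 2 + m
  x<n = <-trans (chords-ascending c x y e) y<n
  i j : Fin (2 + m)
  i = fromℕ< x<n
  j = fromℕ< y<n

-- A word is coded by its representative and by the image there of the side from 0 to 1.
Flagged : ∀ m → List Letter → Graph (2 + m) × Fin (2 + m) × Fin (2 + m) → Set
Flagged m c (t , a , b) = Run 0 m c ×
  Σ (Iso (dissection m c) t) λ τ → Inverse.to (proj₁ τ) zero ≡ a × Inverse.to (proj₁ τ) (suc zero) ≡ b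

-- One isomorphism followed by the inverse of the other fixes 0 and 1, so it is the identity by
-- `fixes-all`. The chords then coincide, and they determine the word.
flagged-injective : ∀ m {c c′ k} → Flagged m c k → Flagged m c′ k → c ≡ c′
flagged-injective m {c} {c′} {t , _} (r , τ , τ0≡ , τ1≡) (r′ , τ′ , τ′0≡ , τ′1≡) =
  run-injective r r′ refl (s≤s z≤n ∷ [])
    (chords-⊆ m c′ r same , chords-⊆ m c r′ λ i j → sym (same i j))
  where
  σ : Iso (dissection m c) (dissection m c′)
  σ = Iso-trans {G = dissection m c} {t} {dissection m c′} τ (Iso-sym {G = dissection m c′} {t} τ′)
  fixed : ∀ v {a} → Inverse.to (proj₁ τ) v ≡ a → Inverse.to (proj₁ τ′) v ≡ a → Inverse.to (proj₁ σ) v ≡ v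
  fixed v e e′ = trans (cong (Inverse.from (proj₁ τ′)) (trans e (sym e′))) (Inverse.strictlyInverseʳ (proj₁ τ′) v)
  σ≡id : ∀ v → Inverse.to (proj₁ σ) v ≡ v
  σ≡id = fixes-all (dissection m c) (dissection m c′) (dissection-path m r) (dissection-closed m r)
    (dissection-noncrossing m c′) σ (fixed zero τ0≡ τ′0≡) (fixed (suc zero) τ1≡ τ′1≡)
  same : ∀ i j → adj (dissection m c) i j ≡ adj (dissection m c′) i j
  same i j = trans (proj₂ σ i j) (cong₂ (adj (dissection m c′)) (σ≡id i) (σ≡id j))

length-cartesianProduct : ∀ {A B : Set} (xs : List A) (ys : List B) →
  length (cartesianProduct xs ys) ≡ length xs * length ys
length-cartesianProduct [] ys = refl
length-cartesianProduct (x ∷ xs) ys = trans (length-++ (map (x ,_) ys))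
  (cong₂ _+_ (length-map (x ,_) ys) (length-cartesianProduct xs ys))

runs-transversal : ∀ m (T : List (Graph (2 + m))) → (∀ G → Outerplanar G → Any (Iso G) T) →
  length (runs 0 m) ≤ length T * ((2 + m) * (2 + m))
runs-transversal m T complete = subst (length (runs 0 m) ≤_) size
  (length-≤-by-codes {P = Flagged m} (λ {_ _ k} → flagged-injective m {k = k}) (runs 0 m) flags (runs-unique 0 m) (All.tabulate flag))
  where
  V : List (Fin (2 + m))
  V = allFin (2 + m)
  |V| : length V ≡ 2 + m
  |V| = length-tabulate id
  flags : List (Graph (2 + m) × Fin (2 + m) × Fin (2 + m))
  flags = cartesianProduct T (cartesianProduct V V)
  size : length flags ≡ length T * ((2 + m) * (2 + m))
  size = trans (length-cartesianProduct T _) (cong (length T *_)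
    (trans (length-cartesianProduct V V) (cong₂ _*_ |V| |V|)))
  flag : ∀ {c} → c ∈ runs 0 m → ∃ λ k → k ∈ flags × Flagged m c k
  flag {c} c∈ with find (complete (dissection m c) (↔-refl , dissection-noncrossing m c))
  ... | t , t∈ , τ = _ , ∈-cartesianProduct⁺ t∈ (∈-cartesianProduct⁺ (∈-allFin _) (∈-allFin _)) ,
    ∈-runs 0 m c∈ , τ , refl , refl

-- Drawings on a line

-- Positions are natural numbers, so that reversing a segment is plain arithmetic.
record Line (n : ℕ) : Set₁ where
  field
    E           : ℕ → ℕ → Set
    E?          : ∀ i j → Dec (E i j)
    E-sym       : ∀ {i j} → E i j → E j i
    E-bounded   : ∀ {i j} → E i j → i < n
    noncrossing : ∀ {a b c d} → E a b → E c d → a < c → c < b → b < d → ⊥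
open Line

record Draws {n : ℕ} (G : Graph n) (E : ℕ → ℕ → Set) : Set where
  field
    place      : Fin n → ℕ
    place<     : ∀ u → place u < n
    unplace    : ∀ {i} → i < n → ∃ λ u → place u ≡ i
    place-inj  : ∀ {u v} → place u ≡ place v → u ≡ v
    adj⇒E      : ∀ u v → adj G u v ≡ true → E (place u) (place v)
    E⇒adj      : ∀ u v → E (place u) (place v) → adj G u v ≡ true
open Draws

draws-iso : ∀ {n} {G H : Graph n} {E E′ : ℕ → ℕ → Set} → Draws G E → Draws H E′ →
  (∀ {i j} → E i j → E′ i j) → (∀ {i j} → E′ i j → E i j) → Iso G H
draws-iso {n} {G} {H} {E} {E′} D D′ to from =
  record { to = σ ; from = τ ; to-cong = cong σ ; from-cong = cong τ
         ; inverse = (λ { {x} refl → place-inj D′ (trans (σ-place (τ x)) (τ-place x)) })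
                   , (λ { {x} refl → place-inj D (trans (τ-place (σ x)) (σ-place x)) }) } ,
  same
  where
  σ τ : Fin n → Fin n
  σ u = proj₁ (unplace D′ (place< D u))
  τ v = proj₁ (unplace D (place< D′ v))
  σ-place : ∀ u → place D′ (σ u) ≡ place D u
  σ-place u = proj₂ (unplace D′ (place< D u))
  τ-place : ∀ v → place D (τ v) ≡ place D′ v
  τ-place v = proj₂ (unplace D (place< D′ v))
  same : ∀ i j → adj G i j ≡ adj H (σ i) (σ j)
  same i j with adj G i j in e | adj H (σ i) (σ j) in e′
  ... | true | true = refl
  ... | false | false = refl
  ... | true | false = trans (sym (E⇒adj D′ _ _ (subst₂ E′ (sym (σ-place i)) (sym (σ-place j)) (to (adj⇒E D i j e))))) e′
  ... | false | true = trans (sym e) (E⇒adj D _ _ (from (subst₂ E′ (σ-place i) (σ-place j) (adj⇒E D′ _ _ e′))))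

-- The circle is cut open before position 0; chords become arcs with the same crossings.
outerplanar-line : ∀ {n} (G : Graph n) → Outerplanar G → Σ (Line n) λ L → Draws G (E L)
outerplanar-line {n} G (π , nc) = L , record
  { place = p ; place< = λ u → toℕ<n (Inverse.to π u)
  ; unplace = λ {i} i<n → Inverse.from π (fromℕ< i<n) ,
      trans (cong toℕ (Inverse.strictlyInverseˡ π (fromℕ< i<n))) (toℕ-fromℕ< i<n)
  ; place-inj = p-inj
  ; adj⇒E = λ u v e → u , v , refl , refl , e
  ; E⇒adj = λ { u v (u′ , v′ , e₁ , e₂ , e) → subst₂ (λ a b → adj G a b ≡ true) (p-inj e₁) (p-inj e₂) e } }
  where
  p : Fin n → ℕ
  p u = toℕ (Inverse.to π u)
  p-inj : ∀ {u v} → p u ≡ p v → u ≡ v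
  p-inj {u} {v} e = trans (sym (Inverse.strictlyInverseʳ π u))
    (trans (cong (Inverse.from π) (toℕ-injective e)) (Inverse.strictlyInverseʳ π v))
  L : Line n
  L = record
    { E = λ i j → ∃ λ u → ∃ λ v → p u ≡ i × p v ≡ j × adj G u v ≡ true
    ; E? = λ i j → Fin.any? λ u → Fin.any? λ v → (p u ≟ i) ×-dec (p v ≟ j) ×-dec (adj G u v Bool.≟ true)
    ; E-sym = λ { (u , v , pu , pv , e) → v , u , pv , pu , trans (adj-sym G v u) e }
    ; E-bounded = λ { (u , _ , pu , _) → subst (_< n) pu (toℕ<n (Inverse.to π u)) }
    ; noncrossing = λ { (u , v , refl , refl , e) (u′ , v′ , refl , refl , e′) → nc u v u′ v′ e e′ } }

Good : ∀ {n} → Line n → ℕ → Set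
Good L i = (∃ λ a → a < i × E L a i) ⊎ (∀ {a d} → a < i → i ≤ d → ¬ E L a d)

least : ∀ {P : ℕ → Set} → (∀ i → Dec (P i)) → ∀ w k →
  (∃ λ b → w ≤ b × b < w + k × P b × (∀ {x} → w ≤ x → x < b → ¬ P x)) ⊎ (∀ {x} → w ≤ x → x < w + k → ¬ P x)
least P? w zero = inj₂ λ w≤x x<w _ → <⇒≱ x<w (subst (_≤ _) (sym (+-identityʳ w)) w≤x)
least {P} P? w (suc k) with P? w
... | yes p = inj₁ (w , ≤-refl , subst (w <_) (sym (+-suc w k)) (s≤s (m≤m+n w k)) , p , λ w≤x x<w _ → <⇒≱ x<w w≤x)
... | no ¬p with least P? (suc w) k
...   | inj₁ (b , w<b , b< , q , min) = inj₁ (b , <⇒≤ w<b , subst (b <_) (sym (+-suc w k)) b< , q , below)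
  where
  below : ∀ {x} → w ≤ x → x < b → ¬ P x
  below w≤x x<b with m≤n⇒m<n∨m≡n w≤x
  ... | inj₁ w<x = min w<x x<b
  ... | inj₂ refl = ¬p
...   | inj₂ none = inj₂ above
  where
  above : ∀ {x} → w ≤ x → x < w + suc k → ¬ P x
  above {x} w≤x x< with m≤n⇒m<n∨m≡n w≤x
  ... | inj₁ w<x = none w<x (subst (x <_) (+-suc w k) x<)
  ... | inj₂ refl = ¬p

-- Every vertex of the segment [w , b) has all its neighbours in [w , b], so reversing
-- [w , b] creates no crossing, while b moves to position w and brings a left neighbour.
module Reversal {n : ℕ} (L : Line n) (w b : ℕ) (w≤b : w ≤ b) (b<n : b < n)
  (a₀ : ℕ) (a₀<w : a₀ < w) (arc : E L a₀ b)
  (minimal : ∀ {x} → w ≤ x → x < b → ¬ ∃ λ a → a < w × E L a x)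
  where

  ρ : ℕ → ℕ
  ρ i with w ≤? i | i ≤? b
  ... | yes _ | yes _ = w + b ∸ i
  ... | _     | _     = i

  ρ-left : ∀ {i} → i < w → ρ i ≡ i
  ρ-left {i} i<w with w ≤? i | i ≤? b
  ... | yes w≤i | _ = ⊥-elim (<⇒≱ i<w w≤i)
  ... | no _ | yes _ = refl
  ... | no _ | no _ = refl

  ρ-right : ∀ {i} → b < i → ρ i ≡ i
  ρ-right {i} b<i with w ≤? i | i ≤? b
  ... | _ | yes i≤b = ⊥-elim (<⇒≱ b<i i≤b)
  ... | yes _ | no _ = refl
  ... | no _ | no _ = refl

  ρ-in : ∀ {i} → w ≤ i → i ≤ b → ρ i + i ≡ w + b
  ρ-in {i} w≤i i≤b with w ≤? i | i ≤? b
  ... | yes _ | yes _ = m∸n+n≡m (≤-trans i≤b (m≤n+m b w))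
  ... | yes _ | no i≰b = ⊥-elim (i≰b i≤b)
  ... | no w≰i | _ = ⊥-elim (w≰i w≤i)

  In : ℕ → Set
  In i = w ≤ i × i ≤ b

  -- The positions that `ρ` maps into [w , b), whose vertices have all their neighbours in [w , b].
  -- Position `w` is left out because it receives `b`.
  Core : ℕ → Set
  Core i = w < i × i ≤ b

  core⇒in : ∀ {i} → Core i → In i
  core⇒in (w<i , i≤b) = <⇒≤ w<i , i≤b

  ρ-In : ∀ {i} → In i → In (ρ i)
  ρ-In {i} (w≤i , i≤b) =
    +-cancelʳ-≤ i w (ρ i) (subst (w + i ≤_) (sym (ρ-in w≤i i≤b)) (+-monoʳ-≤ w i≤b)) ,
    +-cancelʳ-≤ i (ρ i) b (subst (_≤ b + i) (sym (ρ-in w≤i i≤b)) (subst (_≤ b + i) (+-comm b w) (+-monoʳ-≤ b w≤i)))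

  ρ-Core : ∀ {i} → Core i → w ≤ ρ i × ρ i < b
  ρ-Core {i} (w<i , i≤b) = proj₁ (ρ-In (<⇒≤ w<i , i≤b)) ,
    +-cancelʳ-< i (ρ i) b (subst (_< b + i) (sym (ρ-in (<⇒≤ w<i) i≤b)) (subst (_< b + i) (+-comm b w) (+-monoʳ-< b w<i)))

  region : ∀ i → i < w ⊎ In i ⊎ b < i
  region i with w ≤? i | i ≤? b
  ... | yes w≤i | yes i≤b = inj₂ (inj₁ (w≤i , i≤b))
  ... | no w≰i | _ = inj₁ (≰⇒> w≰i)
  ... | _ | no i≰b = inj₂ (inj₂ (≰⇒> i≰b))

  ρρ : ∀ i → ρ (ρ i) ≡ i
  ρρ i with region i
  ... | inj₁ i<w = trans (cong ρ (ρ-left i<w)) (ρ-left i<w)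
  ... | inj₂ (inj₂ b<i) = trans (cong ρ (ρ-right b<i)) (ρ-right b<i)
  ... | inj₂ (inj₁ (w≤i , i≤b)) with ρ-In (w≤i , i≤b)
  ...   | w≤ρi , ρi≤b = +-cancelʳ-≡ (ρ i) (ρ (ρ i)) i
    (trans (ρ-in w≤ρi ρi≤b) (trans (sym (ρ-in w≤i i≤b)) (+-comm (ρ i) i)))

  In-ρ : ∀ {i} → In (ρ i) → In i
  In-ρ {i} p = subst In (ρρ i) (ρ-In p)

  ρ-antitone : ∀ {i j} → In i → In j → i < j → ρ j < ρ i
  ρ-antitone {i} {j} (w≤i , i≤b) (w≤j , j≤b) i<j with ρ j <? ρ i
  ... | yes lt = lt
  ... | no ¬lt = ⊥-elim (<-irrefl (trans (ρ-in w≤i i≤b) (sym (ρ-in w≤j j≤b))) (+-mono-≤-< (≮⇒≥ ¬lt) i<j))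

  ρ-w : ρ w ≡ b
  ρ-w = +-cancelʳ-≡ w (ρ w) b (trans (ρ-in ≤-refl w≤b) (+-comm w b))

  data Outer : ℕ → Set where
    left  : ∀ {i} → i < w → Outer i
    pivot : Outer w
    right : ∀ {i} → b < i → Outer i

  outer : ∀ i → Core i ⊎ Outer i
  outer i with region i
  ... | inj₁ i<w = inj₂ (left i<w)
  ... | inj₂ (inj₂ b<i) = inj₂ (right b<i)
  ... | inj₂ (inj₁ (w≤i , i≤b)) with m≤n⇒m<n∨m≡n w≤i
  ...   | inj₁ w<i = inj₁ (w<i , i≤b)
  ...   | inj₂ refl = inj₂ pivot

  outside-core : ∀ {i} → Outer i → ¬ Core i
  outside-core (left i<w) (w<i , _) = <-asym i<w w<i
  outside-core pivot (w<w , _) = <-irrefl refl w<w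
  outside-core (right b<i) (_ , i≤b) = <⇒≱ b<i i≤b

  -- Without the core, the segment is the single position `w`, and sending it to `b` passes no other
  -- outer position.
  ρ-monotone : ∀ {i j} → Outer i → Outer j → i < j → ρ i < ρ j
  ρ-monotone (left i<w) (left j<w) i<j = subst₂ _<_ (sym (ρ-left i<w)) (sym (ρ-left j<w)) i<j
  ρ-monotone (left i<w) pivot i<j = subst₂ _<_ (sym (ρ-left i<w)) (sym ρ-w) (<-≤-trans i<w w≤b)
  ρ-monotone (left i<w) (right b<j) i<j = subst₂ _<_ (sym (ρ-left i<w)) (sym (ρ-right b<j)) i<j
  ρ-monotone pivot (left j<w) i<j = ⊥-elim (<-asym i<j j<w)
  ρ-monotone pivot pivot i<j = ⊥-elim (<-irrefl refl i<j)
  ρ-monotone pivot (right b<j) i<j = subst₂ _<_ (sym ρ-w) (sym (ρ-right b<j)) b<j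
  ρ-monotone (right b<i) (left j<w) i<j = ⊥-elim (<-irrefl refl (<-trans b<i (<-trans i<j (<-≤-trans j<w w≤b))))
  ρ-monotone (right b<i) pivot i<j = ⊥-elim (<-irrefl refl (<-≤-trans (<-trans b<i i<j) w≤b))
  ρ-monotone (right b<i) (right b<j) i<j = subst₂ _<_ (sym (ρ-right b<i)) (sym (ρ-right b<j)) i<j

  -- A neighbour before `w` contradicts the choice of `b`, and an edge to beyond `b` crosses `arc`.
  segment-closed : ∀ {x y} → w ≤ x → x < b → E L x y → In y
  segment-closed {x} {y} w≤x x<b e with region y
  ... | inj₁ y<w = ⊥-elim (minimal w≤x x<b (y , y<w , E-sym L e))
  ... | inj₂ (inj₁ p) = p
  ... | inj₂ (inj₂ b<y) = ⊥-elim (noncrossing L arc e (<-≤-trans a₀<w w≤x) x<b b<y)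

  E′ : ℕ → ℕ → Set
  E′ i j = E L (ρ i) (ρ j)

  core-closed : ∀ {i j} → Core i → E′ i j → In j
  core-closed c e with ρ-Core c
  ... | w≤ρi , ρi<b = In-ρ (segment-closed w≤ρi ρi<b e)

  -- If one of the four ends is in the core, then so are the inner ends `k` and `j`, and all four
  -- lie in the segment, where `ρ` reverses the order. Otherwise `ρ` preserves it. Either way `L`
  -- would have a crossing.
  noncrossing′ : ∀ {i j k l} → E′ i j → E′ k l → i < k → k < j → j < l → ⊥
  noncrossing′ {i} {j} {k} {l} e e′ i<k k<j j<l with outer k
  ... | inj₁ (w<k , k≤b) = noncrossing L (E-sym L e′) (E-sym L e)
          (ρ-antitone (core⇒in core-j) in-l j<l) (ρ-antitone (<⇒≤ w<k , k≤b) (core⇒in core-j) k<j)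
          (ρ-antitone (core-closed core-j (E-sym L e)) (<⇒≤ w<k , k≤b) i<k)
    where
    in-l : In l
    in-l = core-closed (w<k , k≤b) e′
    core-j : Core j
    core-j = <-trans w<k k<j , ≤-trans (<⇒≤ j<l) (proj₂ in-l)
  ... | inj₂ ok with outer j
  ...   | inj₁ core-j = outside-core ok (≤-<-trans (proj₁ (core-closed core-j (E-sym L e))) i<k , ≤-trans (<⇒≤ k<j) (proj₂ core-j))
  ...   | inj₂ oj with outer i | outer l
  ...     | inj₁ core-i | _ = outside-core oj (<-trans (proj₁ core-i) (<-trans i<k k<j) , proj₂ (core-closed core-i e))
  ...     | inj₂ _ | inj₁ core-l = outside-core oj (≤-<-trans (proj₁ (core-closed core-l (E-sym L e′))) k<j , ≤-trans (<⇒≤ j<l) (proj₂ core-l))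
  ...     | inj₂ oi | inj₂ ol = noncrossing L e e′ (ρ-monotone oi ok i<k) (ρ-monotone ok oj k<j) (ρ-monotone oj ol j<l)

  ρ< : ∀ {i} → i < n → ρ i < n
  ρ< {i} i<n with region i
  ... | inj₁ i<w = subst (_< n) (sym (ρ-left i<w)) i<n
  ... | inj₂ (inj₁ p) = ≤-<-trans (proj₂ (ρ-In p)) b<n
  ... | inj₂ (inj₂ b<i) = subst (_< n) (sym (ρ-right b<i)) i<n

  reversed : Line n
  reversed = record
    { E = E′
    ; E? = λ i j → E? L (ρ i) (ρ j)
    ; E-sym = E-sym L
    ; E-bounded = λ {i} e → subst (_< n) (ρρ i) (ρ< (E-bounded L e))
    ; noncrossing = noncrossing′ }

  reversed-draws : ∀ {G : Graph n} → Draws G (E L) → Draws G E′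
  reversed-draws {G} D = record
    { place = λ u → ρ (place D u)
    ; place< = λ u → ρ< (place< D u)
    ; unplace = λ {i} i<n → let (u , e) = unplace D (ρ< i<n) in u , trans (cong ρ e) (ρρ i)
    ; place-inj = λ {u} {v} e → place-inj D (trans (sym (ρρ (place D u))) (trans (cong ρ e) (ρρ (place D v))))
    ; adj⇒E = λ u v e → subst₂ (E L) (sym (ρρ (place D u))) (sym (ρρ (place D v))) (adj⇒E D u v e)
    ; E⇒adj = λ u v e → E⇒adj D u v (subst₂ (E L) (ρρ (place D u)) (ρρ (place D v)) e) }

  ρ-≥ : ∀ {i d} → i < w → i ≤ d → i ≤ ρ d
  ρ-≥ {i} {d} i<w i≤d with region d
  ... | inj₁ d<w = subst (i ≤_) (sym (ρ-left d<w)) i≤d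
  ... | inj₂ (inj₁ p) = ≤-trans (<⇒≤ i<w) (proj₁ (ρ-In p))
  ... | inj₂ (inj₂ b<d) = subst (i ≤_) (sym (ρ-right b<d)) i≤d

  -- Position `w` now holds `b`, with left neighbour `a₀`. Positions before `w` do not move, and by
  -- `ρ-≥` nothing is carried across a cut there.
  reversed-good : (∀ {i} → i < w → Good L i) → ∀ {i} → i < suc w → Good reversed i
  reversed-good good {i} (s≤s i≤w) with m≤n⇒m<n∨m≡n i≤w
  ... | inj₂ refl = inj₁ (a₀ , a₀<w , subst₂ (E L) (sym (ρ-left a₀<w)) (sym ρ-w) arc)
  ... | inj₁ i<w with good i<w
  ...   | inj₁ (a , a<i , e) = inj₁ (a , a<i , subst₂ (E L) (sym (ρ-left (<-trans a<i i<w))) (sym (ρ-left i<w)) e)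
  ...   | inj₂ none = inj₂ λ a<i i≤d e →
            none a<i (ρ-≥ i<w i≤d) (subst (λ a → E L a _) (ρ-left (<-trans a<i i<w)) e)

-- Position `w` is treated once all earlier ones are good: a reversal brings in the first `b` from
-- `w` on that has a neighbour before `w`. If there is none, no edge passes from before `w` to the
-- rest.
sweep : ∀ {n} {G : Graph n} (L : Line n) → Draws G (E L) → ∀ w → w ≤ n →
  Σ (Line n) λ L′ → Draws G (E L′) × (∀ {i} → i < w → Good L′ i)
sweep L D zero _ = L , D , λ ()
sweep {n} {G} L₀ D₀ (suc w) w<n with sweep L₀ D₀ w (<⇒≤ w<n)
... | L , D , good with least (λ x → anyUpTo? (λ a → E? L a x) w) w (n ∸ w)
...   | inj₂ none = L , D , good′
  where
  good′ : ∀ {i} → i < suc w → Good L i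
  good′ (s≤s i≤w) with m≤n⇒m<n∨m≡n i≤w
  ... | inj₁ i<w = good i<w
  ... | inj₂ refl = inj₂ λ a<w w≤d e →
    none w≤d (subst (_ <_) (sym (m+[n∸m]≡n (<⇒≤ w<n))) (E-bounded L (E-sym L e))) (_ , a<w , e)
...   | inj₁ (b , w≤b , b< , (a₀ , a₀<w , arc) , min) =
  R.reversed , R.reversed-draws D , R.reversed-good good
  where module R = Reversal L w b w≤b (subst (b <_) (m+[n∸m]≡n (<⇒≤ w<n)) b<) a₀ a₀<w arc min

-- Encoding triangle-free drawings

flush : ∀ h u p {c} → c ∈ sparse u p → replicate h (pop false) ++ c ∈ sparse u (h + p)
flush zero u p c∈ = c∈
flush (suc h) u p c∈ = pop-sparse u (h + p) (flush h u p c∈)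

edges-flush : ∀ c {w} s → edges (replicate (length s) (pop false) ++ c) w s ≡ edges c w []
edges-flush c [] = refl
edges-flush c (x ∷ s) = edges-flush c s

module Scan {n : ℕ} (L : Line n) (good : ∀ {i} → i < n → Good L i)
  (triangle-free : ∀ {x y z} → E L x y → E L y z → E L x z → ⊥) where

  data Linked : List ℕ → Set where
    []  : Linked []
    [-] : ∀ {x} → Linked (x ∷ [])
    _∷_ : ∀ {x y s} → E L y x → Linked (y ∷ s) → Linked (x ∷ y ∷ s)

  linked-tail : ∀ {x s} → Linked (x ∷ s) → Linked s
  linked-tail [-] = []
  linked-tail (_ ∷ l) = l

  -- Only edges past `w` count, because a vertex popped by `w` may be adjacent to `w` itself.
  Visible : ℕ → List ℕ → Set
  Visible w s = ∀ {x d} → x < w → w < d → E L x d → x ∈ s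

  -- The invariant in the middle of the pops of `w`: edges to `w` from popped vertices are already
  -- written, so `now` concerns only the remaining stack.
  record Encodes (c : List Letter) (w : ℕ) (s : List ℕ) : Set where
    field
      now   : ∀ {x} → x ∈ s → E L x w → (x , w) ∈ edges c w s
      later : ∀ {x y} → w < y → x < y → E L x y → (x , y) ∈ edges c w s
      sound : ∀ {x y} → (x , y) ∈ edges c w s → E L x y
  open Encodes

  EncodesAll : List Letter → ℕ → List ℕ → Set
  EncodesAll c w s = (∀ {x y} → w ≤ y → x < y → E L x y → (x , y) ∈ edges c w s) ×
    (∀ {x y} → (x , y) ∈ edges c w s → E L x y)

  -- Each vertex on the stack or still to come is popped exactly once, which gives the number of
  -- pops.
  Scanned : ℕ → ℕ → List ℕ → Set
  Scanned u w s = ∃ λ c → c ∈ sparse u (length s + u) × EncodesAll c w s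

  Attached : ℕ → ℕ → List ℕ → Set
  Attached u w s = ∃ λ c → c ∈ sparse (suc u) (length s + suc u) × Encodes c w s

  -- If `w` has no neighbour on the stack, it has no left neighbour at all; `good` then yields a
  -- cut, so the stack is emptied and a new component starts.
  scan : ∀ u w s → w + u ≡ n → Below w s → Linked s → (∀ {x d} → x < w → w ≤ d → E L x d → x ∈ s) → Scanned u w s
  -- The top is popped as long as some lower entry is adjacent to `w`; the leftmost neighbour is the
  -- one `w` is pushed on.
  attach : ∀ u w s → w + suc u ≡ n → Below w s → Linked s → Visible w s → Any (λ y → E L y w) s → Attached u w s

  w<n : ∀ {w u} → w + suc u ≡ n → w < n
  w<n {w} {u} eq = subst (w <_) eq (m<m+n w (s≤s z≤n))

  shift : ∀ {w u} → w + suc u ≡ n → suc w + u ≡ n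
  shift {w} {u} eq = trans (sym (+-suc w u)) eq

  attach u w (x ∷ s) eq (x<w ∷ b) l vis any with Any.any? (λ y → E? L y w) s
  attach u w (x ∷ s) eq (x<w ∷ b) l vis (there any) | no none = ⊥-elim (none any)
  attach u w (x ∷ s) eq (x<w ∷ b) l vis (here e) | no none
    with scan u (suc w) (w ∷ x ∷ s) (shift eq) (≤-refl ∷ x<w ∷ b) (e ∷ l) vis′
    where
    vis′ : ∀ {y d} → y < suc w → suc w ≤ d → E L y d → y ∈ w ∷ x ∷ s
    vis′ (s≤s y≤w) w<d e′ with m≤n⇒m<n∨m≡n y≤w
    ... | inj₁ y<w = there (vis y<w w<d e′)
    ... | inj₂ refl = here refl
  ... | c , c∈ , complete , snd = push ∷ c ,
    push-sparse u _ (subst (λ p → c ∈ sparse u p) (cong suc (sym (+-suc (length s) u))) c∈) ,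
    record { now = λ { (here refl) _ → here refl ; (there y∈) e′ → ⊥-elim (none (lose y∈ e′)) }
           ; later = λ w<y x<y e′ → there (complete w<y x<y e′)
           ; sound = λ { (here refl) → e ; (there q) → snd q } }
  attach u w (x ∷ s) eq (x<w ∷ b) l vis any | yes any′ with E? L x w
  ... | no ¬e with attach u w s eq (weaken (<⇒≤ x<w) b) (linked-tail l) vis′ any′
    where
    -- The popped `x` is no longer needed: an edge from it past `w` would cross the edge from a
    -- lower neighbour `z` to `w`.
    vis′ : Visible w s
    vis′ y<w w<d e′ with vis y<w w<d e′
    ... | there y∈ = y∈
    ... | here refl with find any′
    ...   | z , z∈ , ez = ⊥-elim (noncrossing L ez e′ (∈-below b z∈) y<w w<d)
  ...   | c , c∈ , enc = pop false ∷ c , pop-sparse (suc u) _ c∈ ,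
    record { now = λ { (here refl) e′ → ⊥-elim (¬e e′) ; (there y∈) e′ → now enc y∈ e′ }
           ; later = later enc ; sound = sound enc }
  attach u w (x ∷ y ∷ s) eq (x<w ∷ y<x ∷ b) (e′ ∷ l) vis any | yes any′ | yes e = result any′
    where
    -- Stack neighbours `x` and `y` are adjacent, so an edge from `y` to `w` would close a triangle;
    -- hence the block `pop true`, `pop false`.
    ¬yw : ¬ E L y w
    ¬yw e″ = triangle-free e′ e e″
    result : Any (λ y → E L y w) (y ∷ s) → Attached u w (x ∷ y ∷ s)
    result (here e″) = ⊥-elim (¬yw e″)
    result (there any″) with attach u w s eq (weaken (<⇒≤ (<-trans y<x x<w)) b) (linked-tail l) vis′ any″
      where
      vis′ : Visible w s
      vis′ z<w w<d f with vis z<w w<d f | find any″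
      ... | there (there z∈) | _ = z∈
      ... | here refl | v , v∈ , ev = ⊥-elim (noncrossing L ev f (<-trans (∈-below b v∈) y<x) z<w w<d)
      ... | there (here refl) | v , v∈ , ev = ⊥-elim (noncrossing L ev f (∈-below b v∈) z<w w<d)
    ... | c , c∈ , enc = pop true ∷ pop false ∷ c , skip-sparse (suc u) _ c∈ ,
      record { now = λ { (here refl) _ → here refl ; (there (here refl)) f → ⊥-elim (¬yw f) ; (there (there z∈)) f → there (now enc z∈ f) }
             ; later = λ w<y x<y f → there (later enc w<y x<y f)
             ; sound = λ { (here refl) → e ; (there q) → sound enc q } }

  -- The final pops write no edge; they make the number of pops exact.
  scan zero w s eq b l vis = replicate (length s) (pop false) ++ [] , flush (length s) 0 0 (here refl) ,
    (λ {x} {y} w≤y x<y e → ⊥-elim (<⇒≱ (E-bounded L (E-sym L e)) (subst (_≤ y) (trans (sym (+-identityʳ w)) eq) w≤y))) ,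
    λ {x} {y} q → ⊥-elim (nothing (subst ((x , y) ∈_) (edges-flush [] s) q))
    where
    nothing : ∀ {e : ℕ × ℕ} → ¬ e ∈ []
    nothing ()
  scan (suc u) w s eq b l vis with Any.any? (λ y → E? L y w) s
  ... | yes any with attach u w s eq b l (λ x<w w<d → vis x<w (<⇒≤ w<d)) any
  ...   | c , c∈ , enc = c , c∈ , complete , sound enc
    where
    complete : ∀ {x y} → w ≤ y → x < y → E L x y → (x , y) ∈ edges c w s
    complete w≤y x<y e with m≤n⇒m<n∨m≡n w≤y
    ... | inj₁ w<y = later enc w<y x<y e
    ... | inj₂ refl = now enc (vis x<y ≤-refl e) e
  scan (suc u) w s eq b l vis | no none
    with scan u (suc w) (w ∷ []) (shift eq) (≤-refl ∷ []) [-] vis′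
    where
    separated : ∀ {x d} → x < w → w ≤ d → ¬ E L x d
    separated with good (w<n eq)
    ... | inj₁ (a , a<w , e) = ⊥-elim (none (lose (vis a<w ≤-refl e) e))
    ... | inj₂ sep = sep
    vis′ : ∀ {x d} → x < suc w → suc w ≤ d → E L x d → x ∈ w ∷ []
    vis′ (s≤s x≤w) w<d e with m≤n⇒m<n∨m≡n x≤w
    ... | inj₁ x<w = ⊥-elim (separated x<w (<⇒≤ w<d) e)
    ... | inj₂ refl = here refl
  ... | c , c∈ , complete , snd = replicate (length s) (pop false) ++ push ∷ c ,
    flush (length s) (suc u) (suc u) (push-sparse u (suc u) c∈) ,
    complete′ ,
    λ {x} {y} q → snd (subst ((x , y) ∈_) (edges-flush (push ∷ c) s) q)
    where
    complete′ : ∀ {x y} → w ≤ y → x < y → E L x y → (x , y) ∈ edges (replicate (length s) (pop false) ++ push ∷ c) w s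
    complete′ {x} {y} w≤y x<y e with m≤n⇒m<n∨m≡n w≤y
    ... | inj₁ w<y = subst ((x , y) ∈_) (sym (edges-flush (push ∷ c) s)) (complete w<y x<y e)
    ... | inj₂ refl = ⊥-elim (none (lose (vis x<y ≤-refl e) e))

TriangleFree : ∀ {n} → Graph n → Set
TriangleFree G = ∀ {u v w} → adj G u v ≡ true → adj G v w ≡ true → adj G u w ≡ true → ⊥

Coded : ∀ {n} → Graph n → List Letter → Set
Coded G c = Draws G (Joined (edges c 0 []))

coded-iso : ∀ {n} {G H : Graph n} {c} → Coded G c → Coded H c → Iso G H
coded-iso D D′ = draws-iso D D′ id id

coding : ∀ {n} (G : Graph n) → Outerplanar G → TriangleFree G → ∃ λ c → c ∈ sparse n n × Coded G c
coding {n} G out tf with outerplanar-line G out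
... | L₀ , D₀ with sweep L₀ D₀ n ≤-refl
...   | L , D , good with Scan.scan L good tf′ n 0 [] refl [] Scan.[] (λ ())
  where
  tf′ : ∀ {x y z} → E L x y → E L y z → E L x z → ⊥
  tf′ e₁ e₂ e₃ with unplace D (E-bounded L e₁) | unplace D (E-bounded L e₂) | unplace D (E-bounded L (E-sym L e₂))
  ... | u , refl | v , refl | w , refl = tf (E⇒adj D u v e₁) (E⇒adj D v w e₂) (E⇒adj D u w e₃)
...     | c , c∈ , complete , sound = c , c∈ , record
  { place = place D ; place< = place< D ; unplace = unplace D ; place-inj = place-inj D
  ; adj⇒E = λ u v e → to u v (adj⇒E D u v e) e
  ; E⇒adj = λ { u v (inj₁ q) → E⇒adj D u v (sound q) ; u v (inj₂ q) → E⇒adj D u v (E-sym L (sound q)) } }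
  where
  to : ∀ u v → E L (place D u) (place D v) → adj G u v ≡ true → Joined (edges c 0 []) (place D u) (place D v)
  to u v e a with <-cmp (place D u) (place D v)
  ... | tri< lt _ _ = inj₁ (complete z≤n lt e)
  ... | tri> _ _ gt = inj₂ (complete z≤n gt (E-sym L e))
  ... | tri≈ _ eq _ with place-inj D eq
  ...   | refl with trans (sym a) (adj-irrefl G u)
  ...     | ()

-- Colouring and the comparison of the two counts

third : ∀ (α β : Fin 3) → ∃ λ γ → γ ≢ α × γ ≢ β
third = toWitness {a? = Fin.all? λ α → Fin.all? λ β → Fin.any? λ γ → ¬? (γ Fin.≟ α) ×-dec ¬? (γ Fin.≟ β)} tt

module Colouring {n : ℕ} (L : Line n) where

  Proper : ℕ → ℕ → (ℕ → Fin 3) → Set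
  Proper i j c = ∀ {x y} → i ≤ x → x < y → y ≤ j → E L x y → c x ≢ c y

  -- No edge other than i j passes over k.
  Splitter : ℕ → ℕ → Set
  Splitter i j = ∃ λ k → i < k × k < j ×
    (∀ {x y} → i ≤ x → x < k → k < y → y ≤ j → E L x y → x ≡ i × y ≡ j)

  -- The first neighbour of `j` after `i` works: another edge over it would cross its edge to `j` or
  -- give an earlier neighbour. If `j` has no neighbour strictly between, its predecessor works.
  splitter : ∀ i j → suc i < j → Splitter i j
  splitter i (suc j) (s≤s i<j) with least (λ x → E? L x (suc j)) (suc i) (j ∸ i)
  ... | inj₁ (k , i<k , k< , e , min) = k , i<k , k<′ , only
    where
    k<′ : k < suc j
    k<′ = subst (k <_) (cong suc (m+[n∸m]≡n (<⇒≤ i<j))) k<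
    only : ∀ {x y} → i ≤ x → x < k → k < y → y ≤ suc j → E L x y → x ≡ i × y ≡ suc j
    only i≤x x<k k<y y≤j e′ with m≤n⇒m<n∨m≡n y≤j | m≤n⇒m<n∨m≡n i≤x
    ... | inj₁ y<j | _ = ⊥-elim (noncrossing L e′ e x<k k<y y<j)
    ... | inj₂ refl | inj₁ i<x = ⊥-elim (min i<x x<k e′)
    ... | inj₂ refl | inj₂ refl = refl , refl
  ... | inj₂ none = j , i<j , ≤-refl , only
    where
    only : ∀ {x y} → i ≤ x → x < j → j < y → y ≤ suc j → E L x y → x ≡ i × y ≡ suc j
    only {x} i≤x x<j j<y y≤j e′ with ≤-antisym y≤j j<y | m≤n⇒m<n∨m≡n i≤x
    ... | refl | inj₁ i<x = ⊥-elim (none i<x (subst (x <_) (cong suc (sym (m+[n∸m]≡n (<⇒≤ i<j)))) (m<n⇒m<1+n x<j)) e′)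
    ... | refl | inj₂ refl = refl , refl

  -- The splitter gets the third colour, and both halves are coloured by induction. Only an edge
  -- from `i` to `j` can join the halves across it, and its ends differ. `N` bounds the length of
  -- the interval.
  colour : ∀ N i j → i < j → j ≤ N + i → ∀ α β → α ≢ β →
    ∃ λ c → c i ≡ α × c j ≡ β × Proper i j c
  colour zero i j i<j j≤i = ⊥-elim (<⇒≱ i<j j≤i)
  colour (suc N) i j i<j j≤ α β α≢β with m≤n⇒m<n∨m≡n i<j
  ... | inj₂ refl = c , c-i , c-j , proper
    where
    c : ℕ → Fin 3
    c x with x ≟ i
    ... | yes _ = α
    ... | no _ = β
    c-i : c i ≡ α
    c-i with i ≟ i
    ... | yes _ = refl
    ... | no i≢i = ⊥-elim (i≢i refl)
    c-j : c (suc i) ≡ β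
    c-j with suc i ≟ i
    ... | yes e = ⊥-elim (1+n≢n e)
    ... | no _ = refl
    proper : Proper i (suc i) c
    proper i≤x x<y y≤ e with ≤-antisym (≤-pred (≤-trans x<y y≤)) i≤x
    ... | refl with ≤-antisym y≤ x<y
    ...   | refl = subst₂ _≢_ (sym c-i) (sym c-j) α≢β
  ... | inj₁ 1+i<j with splitter i j 1+i<j | third α β
  ...   | k , i<k , k<j , only | γ , γ≢α , γ≢β
    with colour N i k i<k (≤-pred (≤-trans k<j j≤)) α γ (γ≢α ∘ sym)
       | colour N k j k<j (≤-trans j≤ (subst (_≤ N + k) (+-suc N i) (+-monoʳ-≤ N i<k))) γ β γ≢β
  ...     | c₁ , c₁i , c₁k , proper₁ | c₂ , c₂k , c₂j , proper₂ =
    c , trans (lower (<⇒≤ i<k)) c₁i , trans (upper (<⇒≤ k<j)) c₂j , proper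
    where
    c : ℕ → Fin 3
    c x with x ≤? k
    ... | yes _ = c₁ x
    ... | no _ = c₂ x
    lower : ∀ {x} → x ≤ k → c x ≡ c₁ x
    lower {x} x≤k with x ≤? k
    ... | yes _ = refl
    ... | no x≰k = ⊥-elim (x≰k x≤k)
    upper : ∀ {x} → k ≤ x → c x ≡ c₂ x
    upper {x} k≤x with x ≤? k
    ... | no _ = refl
    ... | yes x≤k with ≤-antisym x≤k k≤x
    ...   | refl = trans c₁k (sym c₂k)
    proper : Proper i j c
    proper {x} {y} i≤x x<y y≤j e with ≤-<-connex y k | ≤-<-connex k x
    ... | inj₁ y≤k | _ = subst₂ _≢_ (sym (lower (≤-trans (<⇒≤ x<y) y≤k))) (sym (lower y≤k)) (proper₁ i≤x x<y y≤k e)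
    ... | inj₂ _ | inj₁ k≤x = subst₂ _≢_ (sym (upper k≤x)) (sym (upper (≤-trans k≤x (<⇒≤ x<y)))) (proper₂ k≤x x<y y≤j e)
    ... | inj₂ k<y | inj₂ x<k with only i≤x x<k k<y y≤j e
    ...   | refl , refl = subst₂ _≢_ (sym (trans (lower (<⇒≤ i<k)) c₁i)) (sym (trans (upper (<⇒≤ k<j)) c₂j)) α≢β

outerplanar-3-colourable : ∀ {n} (G : Graph n) → Outerplanar G → Colorable G 3
outerplanar-3-colourable {n} G out with outerplanar-line G out
-- The right end `suc n` lies beyond all vertices, so the interval is nonempty even for `n = 0`.
... | L , D with Colouring.colour L (suc n) 0 (suc n) (s≤s z≤n) (m≤m+n (suc n) 0) zero (suc zero) (λ ())
...   | c , _ , _ , proper = (λ u → c (place D u)) , proper′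
  where
  proper′ : ∀ u v → adj G u v ≡ true → c (place D u) ≢ c (place D v)
  proper′ u v e eq with <-cmp (place D u) (place D v)
  ... | tri< lt _ _ = proper z≤n lt (<⇒≤ (m<n⇒m<1+n (place< D v))) (adj⇒E D u v e) eq
  ... | tri> _ _ gt = proper z≤n gt (<⇒≤ (m<n⇒m<1+n (place< D u))) (E-sym L (adj⇒E D u v e)) (sym eq)
  ... | tri≈ _ same _ with place-inj D same
  ...   | refl with trans (sym e) (adj-irrefl G u)
  ...     | ()

no-three-distinct : ∀ {m} → m < 3 → (a b c : Fin m) → a ≢ b → b ≢ c → a ≢ c → ⊥
no-three-distinct {m} m<3 a b c a≢b b≢c a≢c with Fin.pigeonhole m<3 (lookup (a ∷ᵥ b ∷ᵥ c ∷ᵥ []ᵥ))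
... | zero , suc zero , _ , e = a≢b e
... | zero , suc (suc zero) , _ , e = a≢c e
... | suc zero , suc (suc zero) , _ , e = b≢c e
... | suc zero , suc zero , s≤s () , _
... | suc (suc zero) , suc zero , s≤s () , _
... | suc (suc zero) , suc (suc zero) , s≤s (s≤s ()) , _

triangle-free : ∀ {n} (G : Graph n) → Outerplanar G → ¬ ChromaticNumber G 3 → TriangleFree G
triangle-free G out ¬χ {u} {v} {w} uv vw uw = ¬χ (outerplanar-3-colourable G out , λ m m<3 (c , proper) →
  no-three-distinct m<3 (c u) (c v) (c w) (proper u v uv) (proper v w vw) (proper u w uw))

^-distribʳ-* : ∀ a b n → (a * b) ^ n ≡ a ^ n * b ^ n
^-distribʳ-* a b zero = refl
^-distribʳ-* a b (suc n) = trans (cong (a * b *_) (^-distribʳ-* a b n)) (interchange a b (a ^ n) (b ^ n))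
  where
  interchange : ∀ a b x y → a * b * (x * y) ≡ a * x * (b * y)
  interchange = solve-∀

-- Every vertex costs one push and one pop, of weights 5/9 and 1/3, which gives the rate 9/5 · 3 =
-- 27/5.
bad-bound : ∀ n (B : List (Graph n)) →
  All (λ G → Outerplanar G × ¬ ChromaticNumber G 3) B → AllPairs (λ G H → ¬ Iso G H) B →
  length B * 5 ^ n ≤ 27 ^ n
bad-bound n B bad distinct = begin
  length B * 5 ^ n             ≤⟨ *-monoˡ-≤ (5 ^ n) (length-≤-by-codes {P = Coded} {R = Iso}
                                   (λ {G} {H} {c} → coded-iso {G = G} {H} {c}) B (sparse n n) distinct
                                   (All.map (λ {G} (out , ¬χ) → coding G out (triangle-free G out ¬χ)) bad)) ⟩
  length (sparse n n) * 5 ^ n  ≤⟨ sparse-bound n n ⟩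
  9 ^ n * 3 ^ n                ≡⟨ sym (^-distribʳ-* 9 3 n) ⟩
  27 ^ n                       ∎
  where open ≤-Reasoning

empty-outerplanar : ∀ n → Σ (Graph n) Outerplanar
empty-outerplanar n = record { adj = λ _ _ → false ; sym = λ _ _ → refl ; irrefl = λ _ → refl } , ↔-refl , λ _ _ _ _ ()

transversal-nonempty : ∀ {n} (T : List (Graph n)) → (∀ G → Outerplanar G → Any (Iso G) T) → 1 ≤ length T
transversal-nonempty {n} T complete with T | complete (proj₁ (empty-outerplanar n)) (proj₂ (empty-outerplanar n))
... | _ ∷ _ | _ = s≤s z≤n

1≤max-weight : 1 ≤ max-weight
1≤max-weight = run-weight≤max 0

-- The quotient of the two rates 27/5 and 11/2 is 54/55.
ratio : ∀ n b t → b * 5 ^ n ≤ 27 ^ n → 11 ^ n ≤ 121 * (t * ((1 + n) * (1 + n)) * (2 ^ n * max-weight)) →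
  b * 55 ^ n ≤ 121 * max-weight * ((1 + n) * (1 + n)) * 54 ^ n * t
ratio n b t upper lower = begin
  b * 55 ^ n               ≡⟨ cong (b *_) (^-distribʳ-* 5 11 n) ⟩
  b * (5 ^ n * 11 ^ n)     ≡⟨ sym (*-assoc b (5 ^ n) (11 ^ n)) ⟩
  b * 5 ^ n * 11 ^ n       ≤⟨ *-mono-≤ upper lower ⟩
  27 ^ n * (121 * (t * ((1 + n) * (1 + n)) * (2 ^ n * max-weight))) ≡⟨ regroup (27 ^ n) t ((1 + n) * (1 + n)) (2 ^ n) max-weight ⟩
  121 * max-weight * ((1 + n) * (1 + n)) * (27 ^ n * 2 ^ n) * t
    ≡⟨ cong (λ x → 121 * max-weight * ((1 + n) * (1 + n)) * x * t) (sym (^-distribʳ-* 27 2 n)) ⟩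
  121 * max-weight * ((1 + n) * (1 + n)) * 54 ^ n * t ∎
  where
  open ≤-Reasoning
  regroup : ∀ x t s y k → x * (121 * (t * s * (y * k))) ≡ 121 * k * s * (x * y) * t
  regroup = solve-∀

-- Words count only `n` minus 2 vertices, which costs 121 = 11². The number of flags is rounded up
-- to the square of `1 + n`, the form that `bernoulli` absorbs; for `n` below 2 it suffices that `T`
-- is nonempty.
transversal-bound : ∀ n (T : List (Graph n)) → (∀ G → Outerplanar G → Any (Iso G) T) →
  11 ^ n ≤ 121 * (length T * ((1 + n) * (1 + n)) * (2 ^ n * max-weight))
transversal-bound zero T complete = *-mono-≤ {1} {121} (s≤s z≤n)
  (*-mono-≤ (*-mono-≤ (transversal-nonempty T complete) ≤-refl) (*-mono-≤ {1} {1} ≤-refl 1≤max-weight))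
transversal-bound (suc zero) T complete = *-mono-≤ {11} {121} (m≤m+n 11 110)
  (*-mono-≤ {1} (*-mono-≤ {1} {_} {1} {4} (transversal-nonempty T complete) (s≤s z≤n)) (*-mono-≤ {1} {2} (s≤s z≤n) 1≤max-weight))
transversal-bound (suc (suc m)) T complete = begin
  11 ^ (2 + m)                             ≡⟨ square (11 ^ m) ⟩
  121 * (11 ^ m * run-weight 0)                     ≤⟨ *-monoʳ-≤ 121 (runs-bound 0 m) ⟩
  121 * (length (runs 0 m) * (2 ^ m * max-weight)) ≤⟨ *-monoʳ-≤ 121 (*-mono-≤
    (≤-trans (runs-transversal m T complete) (*-monoʳ-≤ (length T) (*-mono-≤ (n≤1+n (2 + m)) (n≤1+n (2 + m)))))
    (*-monoˡ-≤ max-weight (^-monoʳ-≤ 2 (m≤n+m m 2)))) ⟩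
  121 * (length T * ((3 + m) * (3 + m)) * (2 ^ (2 + m) * max-weight)) ∎
  where
  open ≤-Reasoning
  square : ∀ x → 11 * (11 * x) ≡ 121 * (x * 1)
  square = solve-∀

-- Bernoulli's inequality (1 + 1/M)ⁿ ≥ 1 + n/M, cleared of denominators.
bernoulli : ∀ M n → 1 ≤ M → (1 + n) * M ^ n ≤ M * (1 + M) ^ n
bernoulli M zero 1≤M = subst (1 ≤_) (sym (*-identityʳ M)) 1≤M
bernoulli M (suc n) 1≤M = begin
  (2 + n) * (M * M ^ n)                       ≡⟨ split n M (M ^ n) ⟩
  M * M ^ n + (1 + n) * M ^ n * M             ≤⟨ +-mono-≤ (*-monoʳ-≤ M (^-monoˡ-≤ n (n≤1+n M))) (*-monoˡ-≤ M (bernoulli M n 1≤M)) ⟩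
  M * (1 + M) ^ n + M * (1 + M) ^ n * M       ≡⟨ join M ((1 + M) ^ n) ⟩
  M * ((1 + M) * (1 + M) ^ n)                 ∎
  where
  open ≤-Reasoning
  split : ∀ n M x → (2 + n) * (M * x) ≡ M * x + (1 + n) * x * M
  split = solve-∀
  join : ∀ M x → M * x + M * x * M ≡ M * ((1 + M) * x)
  join = solve-∀

-- Bernoulli, used twice, trades the quadratic factor for the constant M² at the price of
-- multiplying p/q by (1 + 1/M)².
absorb-square : ∀ M → 1 ≤ M → ∀ n b t C p q → b * q ^ n ≤ C * ((1 + n) * (1 + n)) * p ^ n * t →
  b * (q * (M * M)) ^ n ≤ C * (M * M) * (p * ((1 + M) * (1 + M))) ^ n * t
absorb-square M 1≤M n b t C p q le = begin
  b * (q * (M * M)) ^ n                          ≡⟨ cong (b *_) (expand q M) ⟩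
  b * (q ^ n * (M ^ n * M ^ n))                  ≡⟨ sym (*-assoc b (q ^ n) _) ⟩
  b * q ^ n * (M ^ n * M ^ n)                    ≤⟨ *-monoˡ-≤ (M ^ n * M ^ n) le ⟩
  C * ((1 + n) * (1 + n)) * p ^ n * t * (M ^ n * M ^ n) ≡⟨ regroup C (1 + n) (p ^ n) t (M ^ n) ⟩
  C * p ^ n * t * ((1 + n) * M ^ n * ((1 + n) * M ^ n))
    ≤⟨ *-monoʳ-≤ (C * p ^ n * t) (*-mono-≤ (bernoulli M n 1≤M) (bernoulli M n 1≤M)) ⟩
  C * p ^ n * t * (M * (1 + M) ^ n * (M * (1 + M) ^ n)) ≡⟨ collect C (p ^ n) t M ((1 + M) ^ n) ⟩
  C * (M * M) * (p ^ n * ((1 + M) ^ n * (1 + M) ^ n)) * t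
    ≡⟨ cong (λ x → C * (M * M) * x * t) (sym (expand p (1 + M))) ⟩
  C * (M * M) * (p * ((1 + M) * (1 + M))) ^ n * t ∎
  where
  open ≤-Reasoning
  expand : ∀ q M → (q * (M * M)) ^ n ≡ q ^ n * (M ^ n * M ^ n)
  expand q M = trans (^-distribʳ-* q (M * M) n) (cong (q ^ n *_) (^-distribʳ-* M M n))
  regroup : ∀ C s x t y → C * (s * s) * x * t * (y * y) ≡ C * x * t * (s * y * (s * y))
  regroup = solve-∀
  collect : ∀ C x t M z → C * x * t * (M * z * (M * z)) ≡ C * (M * M) * (x * (z * z)) * t
  collect = solve-∀

-- `T` has one graph per isomorphism class and `B` lists distinct bad classes, so the probability is
-- the largest possible quotient of their lengths; it is at most C (p/q)ⁿ.
theorem5 : Σ ℕ λ C → Σ ℕ λ p → Σ ℕ λ q → p < q ×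
    (∀ (n : ℕ) (T B : List (Graph n)) →
    IsOuterplanarTransversal T →
    All (λ G → Outerplanar G × ¬ ChromaticNumber G 3) B →
    AllPairs (λ G H → ¬ Iso G H) B →
    length B * q ^ n ≤ C * p ^ n * length T)
-- M = 220 is large enough for (1 + 1/M)² < 55/54, so the final ratio stays below 1.
theorem5 = 121 * max-weight * (220 * 220) , 54 * (221 * 221) , 55 * (220 * 220) ,
  toWitness {a? = 54 * (221 * 221) <? 55 * (220 * 220)} tt ,
  λ n T B (_ , _ , complete) bad distinct →
    absorb-square 220 (s≤s z≤n) n (length B) (length T) (121 * max-weight) 54 55
      (ratio n (length B) (length T) (bad-bound n B bad distinct) (transversal-bound n T complete))
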